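{- Let $B=B^{r_N,1}\otimes\cdots\otimes B^{r_1,1}$ be a tensor product of KR crystals of type $C_n^{(1)}$ (with $1\le r_i\le n$, in any order), and let $u\in B$ be a ground state. Then there exist indices $i_1,\dots,i_m\in\{0,1,\dots,n\}$ such that, setting $x_0=u$ and $x_k=f_{i_k}(x_{k-1})$, each step is a Demazure arrow (i.e. $\varphi_{i_k}(x_{k-1})>0$, and if $i_k=0$ then moreover $\varepsilon_0(x_{k-1})\ge1$), and the final element $x_m$ contains no barred letter.
   Context: Crystal conventions: $\varepsilon_i(b)=\max\{k:e_i^k(b)\ne\emptyset\}$, $\varphi_i(b)=\max\{k:f_i^k(b)\ne\emptyset\}$; on tensor products $f_i(x\otimes y)=f_i(x)\otimes y$ if $\varepsilon_i(x)\ge\varphi_i(y)$, else $x\otimes f_i(y)$; $e_i(x\otimes y)=e_i(x)\otimes y$ if $\varepsilon_i(x)>\varphi_i(y)$, else $x\otimes e_i(y)$. Alphabet $1<\cdots<n<\bar n<\cdots<\bar1$. For $1\le r\le n$, $B^{r,1}$ is the set of Kashiwara--Nakashima columns of height $r$: strictly increasing $b(1)<\cdots<b(r)$ such that there is no $z\in\{1,\dots,n\}$ with $z=b(p)$, $\bar z=b(q)$ and $q-p\le r-z$. For $1\le i\le n$, $e_i,f_i$ are defined by identifying $b$ with $b(r)\otimes\cdots\otimes b(1)$ with letter operators $f_i(i)=i+1$, $f_i(\overline{i+1})=\bar i$ for $i<n$, $f_n(n)=\bar n$ ($e_i$ the inverse partial maps, other values $\emptyset$). $f_0(b)$ replaces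 $\bar1$ by $1$ and reorders if $\bar1\in b$, else $\emptyset$; $e_0(b)$ replaces $1$ by $\bar1$ if $1\in b$, else $\emptyset$. For $x$ in a crystal let $\varepsilon(x)=\sum_{i=0}^n\varepsilon_i(x)\Lambda_i$, $\varphi(x)=\sum_{i=0}^n\varphi_i(x)\Lambda_i$ (formal combinations of affine fundamental weights). An element $u=u_N\otimes\cdots\otimes u_1\in B$ ($u_k\in B^{r_k,1}$) is a ground state if $\varepsilon(u_1)=\Lambda_0$ and $\varepsilon(u_{k+1})=\varphi(u_k)$ for $1\le k\le N-1$ (equivalently, $u\otimes u_{\Lambda_0}$ is a highest weight element of $B\otimes B(\Lambda_0)$). -}

module Defs where

open import Data.Nat using (ℕ; zero; suc; _+_; _≤_; _<_; _≡ᵇ_; _<ᵇ_; _≤ᵇ_)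
open import Data.Bool using (Bool; true; false; if_then_else_; _∧_)
open import Data.Maybe using (Maybe; just; nothing)
import Data.Maybe as Maybe
open import Data.Vec using (Vec; []; _∷_; reverse; _∷ʳ_; lookup)
open import Data.Fin using (Fin; toℕ)
open import Data.List using (List; []; _∷_)
open import Data.Product using (_×_; _,_)
open import Data.Unit using (⊤; tt)
open import Data.Empty using (⊥)
open import Relation.Nullary using (¬_)
open import Relation.Binary.PropositionalEquality using (_≡_)
import Data.Integer as ℤ

-- Letters of the alphabet 1 < ... < n < n̄ < ... < 1̄
-- ub a = a (unbarred),  br a = ā (barred).  Only 1 ≤ a ≤ n are valid.

data Letter : Set where
  ub : ℕ → Letter
  br : ℕ → Letter

ValidLetter : ℕ → Letter → Set
ValidLetter n (ub a) = 1 ≤ a × a ≤ n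
ValidLetter n (br a) = 1 ≤ a × a ≤ n

_<L_ : Letter → Letter → Set
ub a <L ub b = a < b
ub a <L br b = ⊤
br a <L ub b = ⊥
br a <L br b = b < a

-- A (seminormal) crystal structure on a carrier A given by the partial
-- operators e_i, f_i (i : ℕ; nothing = ∅).  `bound` is an upper bound for
-- all ε_i, φ_i, used as fuel: ε_i(b) = max{k : e_i^k(b) ≠ ∅} is computed
-- by iterating e_i at most (bound+1) times.

record Crys (A : Set) : Set where
  field
    e f   : ℕ → A → Maybe A
    bound : ℕ
open Crys public

count : {A : Set} → ℕ → (A → Maybe A) → A → ℕ
count zero    g a = 0
count (suc k) g a with g a
... | nothing = 0
... | just a' = suc (count k g a')

εC : {A : Set} → Crys A → ℕ → A → ℕ
εC C i x = count (suc (bound C)) (e C i) x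

φC : {A : Set} → Crys A → ℕ → A → ℕ
φC C i x = count (suc (bound C)) (f C i) x

unitC : {A : Set} → Crys A
unitC = record { e = λ _ _ → nothing ; f = λ _ _ → nothing ; bound = 0 }

_⊗C_ : {A B : Set} → Crys A → Crys B → Crys (A × B)
C ⊗C D = record { e = e' ; f = f' ; bound = bound C + bound D }
  where
  f' : ℕ → _ → Maybe _
  f' i (x , y) = if φC D i y ≤ᵇ εC C i x
                 then Maybe.map (λ x' → (x' , y)) (f C i x)
                 else Maybe.map (λ y' → (x , y')) (f D i y)
  e' : ℕ → _ → Maybe _
  e' i (x , y) = if φC D i y <ᵇ εC C i x
                 then Maybe.map (λ x' → (x' , y)) (e C i x)
                 else Maybe.map (λ y' → (x , y')) (e D i y)

-- same, for a vector x ∷ xs read as x ⊗ xs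
consC : {A : Set} {k : ℕ} → Crys A → Crys (Vec A k) → Crys (Vec A (suc k))
consC {A} {k} C D = record { e = e' ; f = f' ; bound = bound C + bound D }
  where
  f' : ℕ → Vec A (suc k) → Maybe (Vec A (suc k))
  f' i (x ∷ y) = if φC D i y ≤ᵇ εC C i x
                 then Maybe.map (λ x' → x' ∷ y) (f C i x)
                 else Maybe.map (λ y' → x ∷ y') (f D i y)
  e' : ℕ → Vec A (suc k) → Maybe (Vec A (suc k))
  e' i (x ∷ y) = if φC D i y <ᵇ εC C i x
                 then Maybe.map (λ x' → x' ∷ y) (e C i x)
                 else Maybe.map (λ y' → x ∷ y') (e D i y)

-- Letter operators for 1 ≤ i ≤ n (type C_n):
--  f_i(i) = i+1, f_i(\overline{i+1}) = ī  (i < n),  f_n(n) = n̄.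
-- e_i are the inverse partial maps.  Index 0 acts trivially on letters
-- (e_0,f_0 are defined directly on columns below).

fLet : ℕ → ℕ → Letter → Maybe Letter
fLet n zero    _      = nothing
fLet n (suc j) (ub a) =
  if (a ≡ᵇ suc j) ∧ (suc j <ᵇ n) then just (ub (suc a))
  else if (a ≡ᵇ suc j) ∧ (suc j ≡ᵇ n) then just (br n)
  else nothing
fLet n (suc j) (br a) =
  if (suc j <ᵇ n) ∧ (a ≡ᵇ suc (suc j)) then just (br (suc j)) else nothing

eLet : ℕ → ℕ → Letter → Maybe Letter
eLet n zero    _      = nothing
eLet n (suc j) (ub a) =
  if (suc j <ᵇ n) ∧ (a ≡ᵇ suc (suc j)) then just (ub (suc j)) else nothing
eLet n (suc j) (br a) =
  if (a ≡ᵇ suc j) ∧ (suc j <ᵇ n) then just (br (suc a))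
  else if (a ≡ᵇ n) ∧ (suc j ≡ᵇ n) then just (ub n)
  else nothing

letC : ℕ → Crys Letter
letC n = record { e = eLet n ; f = fLet n ; bound = 1 }

-- words x_1 ⊗ ... ⊗ x_k of letters (head = leftmost tensor factor)
wordC : ℕ → (k : ℕ) → Crys (Vec Letter k)
wordC n zero    = unitC
wordC n (suc k) = consC (letC n) (wordC n k)

-- Columns of height r, stored as b = [b(1), ..., b(r)] (increasing).

removeL : {k : ℕ} → (Letter → Bool) → Vec Letter (suc k) → Maybe (Vec Letter k)
removeL {zero}  p (x ∷ []) = if p x then just [] else nothing
removeL {suc k} p (x ∷ xs) = if p x then just xs else Maybe.map (λ v → x ∷ v) (removeL p xs)

isBar1 : Letter → Bool
isBar1 (ub _) = false
isBar1 (br a) = a ≡ᵇ 1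

isOne : Letter → Bool
isOne (ub a) = a ≡ᵇ 1
isOne (br _) = false

-- f_0: replace 1̄ by 1 and reorder (1 is the smallest letter, so it goes first)
f0Col : {r : ℕ} → Vec Letter r → Maybe (Vec Letter r)
f0Col {zero}  []  = nothing
f0Col {suc k} b   = Maybe.map (λ v → ub 1 ∷ v) (removeL isBar1 b)

-- e_0: replace 1 by 1̄ and reorder (1̄ is the largest letter, so it goes last)
e0Col : {r : ℕ} → Vec Letter r → Maybe (Vec Letter r)
e0Col {zero}  []  = nothing
e0Col {suc k} b   = Maybe.map (λ v → v ∷ʳ br 1) (removeL isOne b)

-- KR crystal B^{r,1} of type C_n^{(1)} (operators on words of length r;
-- for i ≥ 1 the column b is identified with b(r) ⊗ ... ⊗ b(1)).
colC : ℕ → (r : ℕ) → Crys (Vec Letter r)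
colC n r = record { e = e' ; f = f' ; bound = r }
  where
  f' : ℕ → Vec Letter r → Maybe (Vec Letter r)
  f' zero    b = f0Col b
  f' (suc j) b = Maybe.map reverse (f (wordC n r) (suc j) (reverse b))
  e' : ℕ → Vec Letter r → Maybe (Vec Letter r)
  e' zero    b = e0Col b
  e' (suc j) b = Maybe.map reverse (e (wordC n r) (suc j) (reverse b))

-- Kashiwara–Nakashima column condition (positions p,q are 0-based Fin
-- indices here; only their difference q - p matters).
IsKNColumn : (n r : ℕ) → Vec Letter r → Set
IsKNColumn n r b =
    (∀ (p : Fin r) → ValidLetter n (lookup b p))
  × (∀ (p q : Fin r) → toℕ p < toℕ q → lookup b p <L lookup b q)
  × (∀ (z : ℕ) (p q : Fin r) → 1 ≤ z → z ≤ n →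
       lookup b p ≡ ub z → lookup b q ≡ br z →
       ¬ ((ℤ.+ toℕ q) ℤ.- (ℤ.+ toℕ p) ℤ.≤ (ℤ.+ r) ℤ.- (ℤ.+ z)))

-- Tensor product B = B^{r_N,1} ⊗ ... ⊗ B^{r_1,1}, rs = [r_N, ..., r_1].

Tens : List ℕ → Set
Tens []       = ⊤
Tens (r ∷ rs) = Vec Letter r × Tens rs

tensC : ℕ → (rs : List ℕ) → Crys (Tens rs)
tensC n []       = unitC
tensC n (r ∷ rs) = colC n r ⊗C tensC n rs

InB : (n : ℕ) → (rs : List ℕ) → Tens rs → Set
InB n []       _        = ⊤
InB n (r ∷ rs) (b , bs) = IsKNColumn n r b × InB n rs bs

-- equality of affine weights Σ_{i=0}^n c_i Λ_i
WtEq : ℕ → (ℕ → ℕ) → (ℕ → ℕ) → Set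
WtEq n c d = ∀ i → i ≤ n → c i ≡ d i

Λ₀ : ℕ → ℕ
Λ₀ zero    = 1
Λ₀ (suc _) = 0

GroundState : (n : ℕ) → (rs : List ℕ) → Tens rs → Set
GroundState n []              _              = ⊤
GroundState n (r ∷ [])        (u , _)        = WtEq n (λ i → εC (colC n r) i u) Λ₀
GroundState n (r ∷ r' ∷ rs) (u , (u' , us)) =
  WtEq n (λ i → εC (colC n r) i u) (λ i → φC (colC n r') i u')
  × GroundState n (r' ∷ rs) (u' , us)

data DemazurePath (n : ℕ) (rs : List ℕ) : Tens rs → Tens rs → Set where
  done : ∀ {x} → DemazurePath n rs x x
  step : ∀ {x x' y} (i : ℕ) → i ≤ n →
         0 < φC (tensC n rs) i x →
         (i ≡ 0 → 1 ≤ εC (tensC n rs) 0 x) →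
         f (tensC n rs) i x ≡ just x' →
         DemazurePath n rs x' y → DemazurePath n rs x y

NoBarLetter : Letter → Set
NoBarLetter (ub _) = ⊤
NoBarLetter (br _) = ⊥

NoBar : (rs : List ℕ) → Tens rs → Set
NoBar []       _        = ⊤
NoBar (r ∷ rs) (b , bs) = (∀ (p : Fin r) → NoBarLetter (lookup b p)) × NoBar rs bs

{-# OPTIONS --safe #-}

-- A column u with ε(u) = Λ_a and φ(u) = Λ_b consists of a+1, …, c and the bars of c, …, b+1 for some
-- c ≥ a, b, and the Kashiwara–Nakashima condition gives c ≤ a + b as soon as there are bars.
--
-- Apply f_n^max, f_{n−1}^max, …, f_1^max, f_0^max to an element whose leftmost column with bars is
-- such a ground state column u.  The columns to its left have ε_i = 0 right before f_i^max, so they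
-- obstruct nothing, and each of their letters j is turned into j + 1 (n into 1).  The largest letter
-- of u travels to the bar of 1 and becomes 1, while the letters 1, …, k created by the previous
-- k rounds move up to 2, …, k + 1.  Throughout the round ε_i(u) = δ_{ia} right before f_i^max, which
-- shields the ground state columns t to the right, because φ(t) = Λ_a; as ε_0(t) ≥ 1, all arrows are
-- Demazure.  The bars of u number c − b ≤ a, so k < a in each round and the new letters never meet
-- a + 1.  After finitely many rounds no column has bars.

module Submission where

open import Defs
open import Data.Bool using (Bool; true; false; if_then_else_)
open import Data.Empty using (⊥; ⊥-elim)
open import Data.Fin as Fin using (Fin; toℕ; inject₁; fromℕ)
open import Data.Fin.Properties using (toℕ-inject₁)
import Data.Integer as ℤ
import Data.Integer.Properties as ℤ
open import Data.List using (List; []; _∷_)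
open import Data.List.Relation.Unary.All using (All; []; _∷_)
open import Data.Maybe as Maybe using (Maybe; just; nothing)
open import Data.Nat using (ℕ; zero; suc; _+_; _∸_; _≤_; _<_; _≡ᵇ_; _<ᵇ_; _≤ᵇ_; z≤n; s≤s)
open import Data.Nat.Properties
open import Data.Product using (Σ; ∃; _×_; _,_; proj₁; proj₂)
open import Data.Sum using (_⊎_; inj₁; inj₂)
open import Data.Unit using (⊤; tt)
open import Data.Vec using (Vec; []; _∷_; reverse; _∷ʳ_; lookup; head; tail)
open import Data.Vec.Properties using (reverse-∷; reverse-involutive)
import Data.Vec.Relation.Unary.All as Allᵛ
open import Data.Vec.Relation.Unary.All using ([]; _∷_) renaming (All to Allᵛ)
open import Data.Vec.Relation.Unary.All.Properties using (lookup⁻)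
open import Function using (_∘_; _⟨_⟩_)
open import Relation.Binary.PropositionalEquality
open import Relation.Nullary using (¬_; yes; no; contradiction)
open import Relation.Nullary.Reflects using (Reflects; ofʸ; ofⁿ; fromEquivalence)

private variable
  A B X : Set
  P Q : Letter → Set
  a b c i j k m r : ℕ
  rs : List ℕ

-- Boolean comparison of natural numbers.

≤⇒≤ᵇ-true : ∀ {m n} → m ≤ n → (m ≤ᵇ n) ≡ true
≤⇒≤ᵇ-true {m} {n} m≤n with m ≤ᵇ n | ≤ᵇ-reflects-≤ m n
... | true  | _        = refl
... | false | ofⁿ m≰n = contradiction m≤n m≰n

>⇒≤ᵇ-false : ∀ {m n} → n < m → (m ≤ᵇ n) ≡ false
>⇒≤ᵇ-false {m} {n} n<m with m ≤ᵇ n | ≤ᵇ-reflects-≤ m n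
... | false | _       = refl
... | true  | ofʸ m≤n = contradiction m≤n (<⇒≱ n<m)

<⇒<ᵇ-true : ∀ {m n} → m < n → (m <ᵇ n) ≡ true
<⇒<ᵇ-true = ≤⇒≤ᵇ-true

≥⇒<ᵇ-false : ∀ {m n} → n ≤ m → (m <ᵇ n) ≡ false
≥⇒<ᵇ-false n≤m = >⇒≤ᵇ-false (s≤s n≤m)

≡ᵇ-refl : ∀ m → (m ≡ᵇ m) ≡ true
≡ᵇ-refl zero    = refl
≡ᵇ-refl (suc m) = ≡ᵇ-refl m

-- Crystals with known string lengths.

-- Closed forms for the string lengths at one index. Each operator is related to both functions,
-- since the tensor product rule compares the ε of one factor with the φ of the other; the bounds
-- ensure that the fuel of `εC` and `φC` never runs out.
record Seminormal (C : Crys A) (i : ℕ) : Set where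
  field
    ε φ     : A → ℕ
    ε-bound : ∀ x → ε x ≤ bound C
    φ-bound : ∀ x → φ x ≤ bound C
    e-∅     : ∀ {x} → e C i x ≡ nothing → ε x ≡ 0
    e-step  : ∀ {x x′} → e C i x ≡ just x′ → ε x ≡ suc (ε x′) × φ x′ ≡ suc (φ x)
    f-∅     : ∀ {x} → f C i x ≡ nothing → φ x ≡ 0
    f-step  : ∀ {x x′} → f C i x ≡ just x′ → φ x ≡ suc (φ x′) × ε x′ ≡ suc (ε x)

-- Fuel exceeding `h x` suffices: each application of `g` lowers `h` by one, and `g` can stop only
-- where `h` vanishes.
count-exact : (g : A → Maybe A) (h : A → ℕ) →
  (∀ {x} → g x ≡ nothing → h x ≡ 0) →
  (∀ {x x′} → g x ≡ just x′ → h x ≡ suc (h x′)) →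
  ∀ k x → h x < k → count k g x ≡ h x
count-exact g h g-∅ g-step (suc k) x h<k with g x in eq
... | nothing = sym (g-∅ eq)
... | just x′ rewrite g-step eq = cong suc (count-exact g h g-∅ g-step k x′ (≤-pred h<k))

module _ {C : Crys A} {i : ℕ} (S : Seminormal C i) where
  open Seminormal S

  εC-exact : ∀ x → εC C i x ≡ ε x
  εC-exact x = count-exact (e C i) ε e-∅ (proj₁ ∘ e-step) _ x (s≤s (ε-bound x))

  φC-exact : ∀ x → φC C i x ≡ φ x
  φC-exact x = count-exact (f C i) φ f-∅ (proj₁ ∘ f-step) _ x (s≤s (φ-bound x))

-- Maximal strings of f_i.

data Run (g : A → Maybe A) : A → A → Set where
  []  : ∀ {x} → Run g x x
  _∷_ : ∀ {x y z} → g x ≡ just y → Run g y z → Run g x z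

_++ᴿ_ : {g : A → Maybe A} {x y z : A} → Run g x y → Run g y z → Run g x z
[]       ++ᴿ s = s
(p ∷ r) ++ᴿ s = p ∷ (r ++ᴿ s)

-- The invariant `P` is carried along because a tensor factor moves only under a comparison of
-- string lengths, which has to survive every arrow.
mapᴿ : {g : A → Maybe A} {h : B → Maybe B} (P : A → Set) (t : A → B) →
  (∀ {x y} → P x → g x ≡ just y → h (t x) ≡ just (t y) × P y) →
  ∀ {x y} → P x → Run g x y → Run h (t x) (t y)
mapᴿ P t lift Px []      = []
mapᴿ P t lift Px (p ∷ r) = proj₁ (lift Px p) ∷ mapᴿ P t lift (proj₂ (lift Px p)) r

-- f_i^max x = x′
record FMax {C : Crys A} {i : ℕ} (S : Seminormal C i) (x x′ : A) : Set where
  constructor fmax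
  field
    run   : Run (f C i) x x′
    φ-end : Seminormal.φ S x′ ≡ 0

module _ {C : Crys A} {i : ℕ} (S : Seminormal C i) where
  open Seminormal S

  fmax-refl : ∀ {x} → φ x ≡ 0 → FMax S x x
  fmax-refl = fmax []

  fmax-exists : (P : A → Set) → (∀ {x x′} → f C i x ≡ just x′ → P x → P x′) →
    ∀ {x} → P x → ∃ λ x′ → FMax S x x′ × P x′
  fmax-exists P f-P {x} = go (φ x) ≤-refl
    where
    -- The bound `m` on φ is the recursion measure, as every arrow lowers φ by one.
    go : ∀ m {x} → φ x ≤ m → P x → ∃ λ x′ → FMax S x x′ × P x′
    go m {x} φ≤m Px with f C i x in eq
    ... | nothing = x , fmax-refl (f-∅ eq) , Px
    go zero    φ≤m Px | just x′ with () ← trans (sym (proj₁ (f-step eq))) (n≤0⇒n≡0 φ≤m)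
    go (suc m) φ≤m Px | just x′
      with x″ , fmax r z , Px″ ← go m (≤-pred (subst (_≤ suc m) (proj₁ (f-step eq)) φ≤m)) (f-P eq Px)
      = x″ , fmax (eq ∷ r) z , Px″

-- The tensor product rule.

-- Covers both _⊗C_ (pairs) and consC (vectors).
record IsTensor (C : Crys A) (D : Crys B) (E : Crys X) : Set where
  field
    pair      : A → B → X
    left      : X → A
    right     : X → B
    left-pair  : ∀ {x y} → left (pair x y) ≡ x
    right-pair : ∀ {x y} → right (pair x y) ≡ y
    pair-η    : ∀ z → pair (left z) (right z) ≡ z
    bound-≡   : bound E ≡ bound C + bound D
    f-≡       : ∀ i x y → f E i (pair x y) ≡
                  (if φC D i y ≤ᵇ εC C i x then Maybe.map (λ x′ → pair x′ y) (f C i x)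
                                           else Maybe.map (λ y′ → pair x y′) (f D i y))
    e-≡       : ∀ i x y → e E i (pair x y) ≡
                  (if φC D i y <ᵇ εC C i x then Maybe.map (λ x′ → pair x′ y) (e C i x)
                                           else Maybe.map (λ y′ → pair x y′) (e D i y))

map-just⁻ : (t : A → B) (m : Maybe A) {b : B} → Maybe.map t m ≡ just b →
  ∃ λ a → m ≡ just a × b ≡ t a
map-just⁻ t (just a) refl = a , refl , refl

map-nothing⁻ : {t : A → B} {m : Maybe A} → Maybe.map t m ≡ nothing → m ≡ nothing
map-nothing⁻ {m = nothing} _ = refl

cong-map-just : {t : A → B} {m : Maybe A} {a : A} → m ≡ just a → Maybe.map t m ≡ just (t a)
cong-map-just refl = refl

module Tensor {C : Crys A} {D : Crys B} {E : Crys X} (T : IsTensor C D E)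
              {i : ℕ} (SC : Seminormal C i) (SD : Seminormal D i) where
  open IsTensor T
  module C = Seminormal SC
  module D = Seminormal SD

  f-left : ∀ {x y} → D.φ y ≤ C.ε x → f E i (pair x y) ≡ Maybe.map (λ x′ → pair x′ y) (f C i x)
  f-left {x} {y} φ≤ε rewrite f-≡ i x y | φC-exact SD y | εC-exact SC x | ≤⇒≤ᵇ-true φ≤ε = refl

  f-right : ∀ {x y} → C.ε x < D.φ y → f E i (pair x y) ≡ Maybe.map (pair x) (f D i y)
  f-right {x} {y} ε<φ rewrite f-≡ i x y | φC-exact SD y | εC-exact SC x | >⇒≤ᵇ-false ε<φ = refl

  e-left : ∀ {x y} → D.φ y < C.ε x → e E i (pair x y) ≡ Maybe.map (λ x′ → pair x′ y) (e C i x)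
  e-left {x} {y} φ<ε rewrite e-≡ i x y | φC-exact SD y | εC-exact SC x | <⇒<ᵇ-true φ<ε = refl

  e-right : ∀ {x y} → C.ε x ≤ D.φ y → e E i (pair x y) ≡ Maybe.map (pair x) (e D i y)
  e-right {x} {y} ε≤φ rewrite e-≡ i x y | φC-exact SD y | εC-exact SC x | ≥⇒<ᵇ-false ε≤φ = refl

  -- The standard formulas for string lengths in a tensor product, with truncated subtraction as the
  -- positive part.
  ε⊗ φ⊗ : A → B → ℕ
  ε⊗ x y = D.ε y + (C.ε x ∸ D.φ y)
  φ⊗ x y = C.φ x + (D.φ y ∸ C.ε x)

  f⊗-∅ : ∀ x y → f E i (pair x y) ≡ nothing → φ⊗ x y ≡ 0
  f⊗-∅ x y eq with ≤-<-connex (D.φ y) (C.ε x)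
  ... | inj₁ φ≤ε = cong₂ _+_ (C.f-∅ (map-nothing⁻ (trans (sym (f-left φ≤ε)) eq))) (m≤n⇒m∸n≡0 φ≤ε)
  ... | inj₂ ε<φ = contradiction (subst (C.ε x <_) (D.f-∅ (map-nothing⁻ (trans (sym (f-right ε<φ)) eq))) ε<φ) n≮0

  e⊗-∅ : ∀ x y → e E i (pair x y) ≡ nothing → ε⊗ x y ≡ 0
  e⊗-∅ x y eq with ≤-<-connex (C.ε x) (D.φ y)
  ... | inj₁ ε≤φ = cong₂ _+_ (D.e-∅ (map-nothing⁻ (trans (sym (e-right ε≤φ)) eq))) (m≤n⇒m∸n≡0 ε≤φ)
  ... | inj₂ φ<ε = contradiction (subst (D.φ y <_) (C.e-∅ (map-nothing⁻ (trans (sym (e-left φ<ε)) eq))) φ<ε) n≮0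

  -- The comparison that selects the factor stays true, at least weakly, after the arrow. Hence one
  -- truncated difference is zero before and after, and the other is an honest difference.
  f⊗-step : ∀ x y {z} → f E i (pair x y) ≡ just z →
    φ⊗ x y ≡ suc (φ⊗ (left z) (right z)) × ε⊗ (left z) (right z) ≡ suc (ε⊗ x y)
  f⊗-step x y eq with ≤-<-connex (D.φ y) (C.ε x)
  ... | inj₁ φ≤ε with x′ , fx , refl ← map-just⁻ (λ x′ → pair x′ y) (f C i x) (trans (sym (f-left φ≤ε)) eq)
    rewrite left-pair {x′} {y} | right-pair {x′} {y} | proj₁ (C.f-step fx) | proj₂ (C.f-step fx)
    = cong (λ k → suc (C.φ x′ + k)) (trans (m≤n⇒m∸n≡0 φ≤ε) (sym (m≤n⇒m∸n≡0 (m≤n⇒m≤1+n φ≤ε))))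
    , trans (cong (D.ε y +_) (+-∸-assoc 1 φ≤ε)) (+-suc _ _)
  f⊗-step x y eq | inj₂ ε<φ with y′ , fy , refl ← map-just⁻ (pair x) (f D i y) (trans (sym (f-right ε<φ)) eq)
    with φy , εy ← D.f-step fy
    rewrite left-pair {x} {y′} | right-pair {x} {y′} | φy | εy
    = trans (cong (C.φ x +_) (+-∸-assoc 1 (≤-pred ε<φ))) (+-suc _ _)
    , cong (λ k → suc (D.ε y + k)) (trans (m≤n⇒m∸n≡0 (≤-pred ε<φ)) (sym (m≤n⇒m∸n≡0 (m≤n⇒m≤1+n (≤-pred ε<φ)))))

  e⊗-step : ∀ x y {z} → e E i (pair x y) ≡ just z →
    ε⊗ x y ≡ suc (ε⊗ (left z) (right z)) × φ⊗ (left z) (right z) ≡ suc (φ⊗ x y)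
  e⊗-step x y eq with ≤-<-connex (C.ε x) (D.φ y)
  ... | inj₁ ε≤φ with y′ , ey , refl ← map-just⁻ (pair x) (e D i y) (trans (sym (e-right ε≤φ)) eq)
    rewrite left-pair {x} {y′} | right-pair {x} {y′} | proj₁ (D.e-step ey) | proj₂ (D.e-step ey)
    = cong (λ k → suc (D.ε y′ + k)) (trans (m≤n⇒m∸n≡0 ε≤φ) (sym (m≤n⇒m∸n≡0 (m≤n⇒m≤1+n ε≤φ))))
    , trans (cong (C.φ x +_) (+-∸-assoc 1 ε≤φ)) (+-suc _ _)
  e⊗-step x y eq | inj₂ φ<ε with x′ , ex , refl ← map-just⁻ (λ x′ → pair x′ y) (e C i x) (trans (sym (e-left φ<ε)) eq)
    with εx , φx ← C.e-step ex
    rewrite left-pair {x′} {y} | right-pair {x′} {y} | εx | φx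
    = trans (cong (D.ε y +_) (+-∸-assoc 1 (≤-pred φ<ε))) (+-suc _ _)
    , cong (λ k → suc (C.φ x + k)) (trans (m≤n⇒m∸n≡0 (≤-pred φ<ε)) (sym (m≤n⇒m∸n≡0 (m≤n⇒m≤1+n (≤-pred φ<ε)))))

  seminormal : Seminormal E i
  seminormal = record
    { ε = λ z → ε⊗ (left z) (right z)
    ; φ = λ z → φ⊗ (left z) (right z)
    ; ε-bound = λ z → subst (ε⊗ (left z) (right z) ≤_) (trans (+-comm (bound D) _) (sym bound-≡))
        (+-mono-≤ (D.ε-bound (right z)) (≤-trans (m∸n≤m _ (D.φ (right z))) (C.ε-bound (left z))))
    ; φ-bound = λ z → subst (φ⊗ (left z) (right z) ≤_) (sym bound-≡)
        (+-mono-≤ (C.φ-bound (left z)) (≤-trans (m∸n≤m _ (C.ε (left z))) (D.φ-bound (right z))))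
    ; e-∅    = λ {z} eq → e⊗-∅ _ _ (trans (cong (e E i) (pair-η z)) eq)
    ; e-step = λ {z} eq → e⊗-step _ _ (trans (cong (e E i) (pair-η z)) eq)
    ; f-∅    = λ {z} eq → f⊗-∅ _ _ (trans (cong (f E i) (pair-η z)) eq)
    ; f-step = λ {z} eq → f⊗-step _ _ (trans (cong (f E i) (pair-η z)) eq)
    }

  private
    module E = Seminormal seminormal

    φ-pair : ∀ x y → E.φ (pair x y) ≡ φ⊗ x y
    φ-pair x y = cong₂ φ⊗ left-pair right-pair

    run-left : ∀ {x x′ y} → D.φ y ≤ C.ε x → Run (f C i) x x′ → Run (f E i) (pair x y) (pair x′ y)
    run-left {y = y} = mapᴿ (λ x → D.φ y ≤ C.ε x) (λ x → pair x y) λ φ≤ε fx →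
      trans (f-left φ≤ε) (cong-map-just fx) ,
      ≤-trans φ≤ε (≤-trans (n≤1+n _) (≤-reflexive (sym (proj₂ (C.f-step fx)))))

    run-right : ∀ {x y y′} → C.ε x ≡ 0 → Run (f D i) y y′ → Run (f E i) (pair x y) (pair x y′)
    run-right {x} εx≡0 = mapᴿ (λ _ → C.ε x ≡ 0) (pair x) (λ z fy →
      trans (f-right (subst₂ _<_ (sym z) (sym (proj₁ (D.f-step fy))) (s≤s z≤n))) (cong-map-just fy) , z)
      εx≡0

  -- As ε_i(x) = 0, the rule lets f_i exhaust the right factor first and only then act on the left
  -- one, so the two maximal strings are concatenated.
  fmax-⊗ : ∀ {x x′ y y′} → C.ε x ≡ 0 → FMax SC x x′ → FMax SD y y′ →
    FMax seminormal (pair x y) (pair x′ y′)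
  fmax-⊗ {x} {x′} {y} {y′} εx≡0 (fmax r φx′) (fmax s φy′) = fmax
    (run-right εx≡0 s ++ᴿ run-left (subst (_≤ C.ε x) (sym φy′) z≤n) r)
    (trans (φ-pair x′ y′) (cong₂ _+_ φx′ (trans (cong (_∸ C.ε x′) φy′) (0∸n≡0 (C.ε x′)))))

  -- The left factor is chosen at once, and every arrow on it raises its ε_i, so the right factor is
  -- never reached.
  fmax-shielded : ∀ {x x′ y} → D.φ y ≤ C.ε x → FMax SC x x′ →
    FMax seminormal (pair x y) (pair x′ y)
  fmax-shielded {x} {x′} {y} φ≤ε (fmax r φx′) = fmax (run-left φ≤ε r)
    (trans (φ-pair x′ y) (cong₂ _+_ φx′ (m≤n⇒m∸n≡0 (≤-trans φ≤ε (ε-mono r)))))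
    where
    ε-mono : ∀ {x x′} → Run (f C i) x x′ → C.ε x ≤ C.ε x′
    ε-mono []      = ≤-refl
    ε-mono (p ∷ r) = ≤-trans (n≤1+n _) (≤-trans (≤-reflexive (sym (proj₂ (C.f-step p)))) (ε-mono r))

⊗-tensor : (C : Crys A) (D : Crys B) → IsTensor C D (C ⊗C D)
⊗-tensor C D = record
  { pair = _,_ ; left = proj₁ ; right = proj₂ ; left-pair = refl ; right-pair = refl
  ; pair-η = λ _ → refl ; bound-≡ = refl ; f-≡ = λ _ _ _ → refl ; e-≡ = λ _ _ _ → refl }

cons-tensor : ∀ {k} (C : Crys A) (D : Crys (Vec A k)) → IsTensor C D (consC C D)
cons-tensor C D = record
  { pair = _∷_ ; left = head ; right = tail ; left-pair = refl ; right-pair = refl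
  ; pair-η = λ { (_ ∷ _) → refl } ; bound-≡ = refl ; f-≡ = λ _ _ _ → refl ; e-≡ = λ _ _ _ → refl }

unit-seminormal : ∀ {i} → Seminormal (unitC {A}) i
unit-seminormal = record
  { ε = λ _ → 0 ; φ = λ _ → 0 ; ε-bound = λ _ → z≤n ; φ-bound = λ _ → z≤n
  ; e-∅ = λ _ → refl ; e-step = λ () ; f-∅ = λ _ → refl ; f-step = λ () }

-- The letter crystal of type C_n.

-- The graph of the letter operator with index i + 1; the shift leaves out index 0, which acts
-- trivially on letters.
data Arrow (n i : ℕ) : Letter → Letter → Set where
  up  : suc i < n → Arrow n i (ub (suc i)) (ub (suc (suc i)))
  turn : suc i ≡ n → Arrow n i (ub (suc i)) (br (suc i))
  dn  : suc i < n → Arrow n i (br (suc (suc i))) (br (suc i))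

≡ᵇ-reflects-≡ : ∀ m n → Reflects (m ≡ n) (m ≡ᵇ n)
≡ᵇ-reflects-≡ m n = fromEquivalence (≡ᵇ⇒≡ m n) (≡⇒≡ᵇ m n)

module _ (n : ℕ) where

  fLet⇒Arrow : ∀ {i} l {l′} → fLet n (suc i) l ≡ just l′ → Arrow n i l l′
  fLet⇒Arrow {i} (ub a) eq
    with a ≡ᵇ suc i | ≡ᵇ-reflects-≡ a (suc i) | suc i <ᵇ n | <ᵇ-reflects-< (suc i) n
       | suc i ≡ᵇ n | ≡ᵇ-reflects-≡ (suc i) n
  fLet⇒Arrow (ub _) refl | true | ofʸ refl | true  | ofʸ i<n | _    | _        = up i<n
  fLet⇒Arrow (ub _) refl | true | ofʸ refl | false | _       | true | ofʸ refl = turn refl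
  fLet⇒Arrow {i} (br a) eq
    with suc i <ᵇ n | <ᵇ-reflects-< (suc i) n | a ≡ᵇ suc (suc i) | ≡ᵇ-reflects-≡ a (suc (suc i))
  fLet⇒Arrow (br _) refl | true | ofʸ i<n | true | ofʸ refl = dn i<n

  eLet⇒Arrow : ∀ {i l} l′ → eLet n (suc i) l′ ≡ just l → Arrow n i l l′
  eLet⇒Arrow {i} (ub a) eq
    with suc i <ᵇ n | <ᵇ-reflects-< (suc i) n | a ≡ᵇ suc (suc i) | ≡ᵇ-reflects-≡ a (suc (suc i))
  eLet⇒Arrow (ub _) refl | true | ofʸ i<n | true | ofʸ refl = up i<n
  eLet⇒Arrow {i} (br a) eq
    with a ≡ᵇ suc i | ≡ᵇ-reflects-≡ a (suc i) | suc i <ᵇ n | <ᵇ-reflects-< (suc i) n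
       | a ≡ᵇ n | ≡ᵇ-reflects-≡ a n | suc i ≡ᵇ n | ≡ᵇ-reflects-≡ (suc i) n
  eLet⇒Arrow (br _) refl | true  | ofʸ refl | true  | ofʸ i<n | _    | _        | _    | _        = dn i<n
  eLet⇒Arrow (br _) refl | true  | ofʸ refl | false | _       | true | ofʸ refl | true | ofʸ refl = turn refl
  eLet⇒Arrow (br _) refl | false | ofⁿ a≢i  | _     | _       | true | ofʸ refl | true | ofʸ refl = contradiction refl a≢i

  Arrow⇒fLet : ∀ {i l l′} → Arrow n i l l′ → fLet n (suc i) l ≡ just l′
  Arrow⇒fLet {i} (up i<n)   rewrite ≡ᵇ-refl i | <⇒<ᵇ-true i<n = refl
  Arrow⇒fLet {i} (turn refl) rewrite ≡ᵇ-refl i | ≥⇒<ᵇ-false (≤-refl {i}) = refl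
  Arrow⇒fLet {i} (dn i<n)   rewrite ≡ᵇ-refl i | <⇒<ᵇ-true i<n = refl

  Arrow⇒eLet : ∀ {i l l′} → Arrow n i l l′ → eLet n (suc i) l′ ≡ just l
  Arrow⇒eLet {i} (up i<n)   rewrite ≡ᵇ-refl i | <⇒<ᵇ-true i<n = refl
  Arrow⇒eLet {i} (turn refl) rewrite ≡ᵇ-refl i | ≥⇒<ᵇ-false (≤-refl {i}) = refl
  Arrow⇒eLet {i} (dn i<n)   rewrite ≡ᵇ-refl i | <⇒<ᵇ-true i<n = refl

  -- Strings of letters have length at most one, so a single application of an operator already
  -- decides the string length.
  ¬Arrow-Arrow : ∀ {i l l′ l″} → Arrow n i l l′ → ¬ Arrow n i l′ l″
  ¬Arrow-Arrow (up _)     ()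
  ¬Arrow-Arrow (turn refl) ()
  ¬Arrow-Arrow (dn _)     ()

  private
    size : Maybe Letter → ℕ
    size (just _) = 1
    size nothing  = 0

    size≤1 : ∀ m → size m ≤ 1
    size≤1 (just _) = s≤s z≤n
    size≤1 nothing  = z≤n

    ¬just⇒size : ∀ m → (∀ {l} → m ≢ just l) → size m ≡ 0
    ¬just⇒size (just l) ¬just = contradiction refl ¬just
    ¬just⇒size nothing  _     = refl

    ε-letter φ-letter : ℕ → Letter → ℕ
    ε-letter i l = size (eLet n i l)
    φ-letter i l = size (fLet n i l)

    arrow-ε-source : ∀ {i l l′} → Arrow n i l l′ → ε-letter (suc i) l ≡ 0
    arrow-ε-source {i} {l} a = ¬just⇒size (eLet n (suc i) l) λ eq → ¬Arrow-Arrow (eLet⇒Arrow l eq) a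

    arrow-φ-target : ∀ {i l l′} → Arrow n i l l′ → φ-letter (suc i) l′ ≡ 0
    arrow-φ-target {i} {l′ = l′} a = ¬just⇒size (fLet n (suc i) l′) λ eq → ¬Arrow-Arrow a (fLet⇒Arrow l′ eq)

    arrow-ε : ∀ {i l l′} → Arrow n i l l′ → ε-letter (suc i) l′ ≡ suc (ε-letter (suc i) l)
    arrow-ε a rewrite Arrow⇒eLet a = cong suc (sym (arrow-ε-source a))

    arrow-φ : ∀ {i l l′} → Arrow n i l l′ → φ-letter (suc i) l ≡ suc (φ-letter (suc i) l′)
    arrow-φ a rewrite Arrow⇒fLet a = cong suc (sym (arrow-φ-target a))

  letter-seminormal : ∀ i → Seminormal (letC n) i
  letter-seminormal i = record
    { ε = ε-letter i ; φ = φ-letter i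
    ; ε-bound = λ l → size≤1 (eLet n i l) ; φ-bound = λ l → size≤1 (fLet n i l)
    ; e-∅ = cong size ; f-∅ = cong size
    ; e-step = e-step i ; f-step = f-step i }
    where
    e-step : ∀ i {l l′} → eLet n i l ≡ just l′ →
      ε-letter i l ≡ suc (ε-letter i l′) × φ-letter i l′ ≡ suc (φ-letter i l)
    e-step (suc i) {l} eq = let a = eLet⇒Arrow l eq in arrow-ε a , arrow-φ a
    f-step : ∀ i {l l′} → fLet n i l ≡ just l′ →
      φ-letter i l ≡ suc (φ-letter i l′) × ε-letter i l′ ≡ suc (ε-letter i l)
    f-step (suc i) {l} eq = let a = fLet⇒Arrow l eq in arrow-φ a , arrow-ε a

  module Let (i : ℕ) = Seminormal (letter-seminormal (suc i))

  Arrow⇒FMax : ∀ {i l l′} → Arrow n i l l′ → FMax (letter-seminormal (suc i)) l l′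
  Arrow⇒FMax a = fmax (Arrow⇒fLet a ∷ []) (arrow-φ-target a)

-- String lengths of letters as Kronecker deltas.

δ : ℕ → ℕ → ℕ
δ zero    zero    = 1
δ zero    (suc _) = 0
δ (suc _) zero    = 0
δ (suc i) (suc j) = δ i j

δ-refl : ∀ i → δ i i ≡ 1
δ-refl zero    = refl
δ-refl (suc i) = δ-refl i

δ-≢ : ∀ {i j} → i ≢ j → δ i j ≡ 0
δ-≢ {zero}  {zero}  i≢j = contradiction refl i≢j
δ-≢ {zero}  {suc j} i≢j = refl
δ-≢ {suc i} {zero}  i≢j = refl
δ-≢ {suc i} {suc j} i≢j = δ-≢ (i≢j ∘ cong suc)

δ≢0⇒≡ : ∀ {i j} → 1 ≤ δ i j → i ≡ j
δ≢0⇒≡ {i} {j} 1≤δ with i ≟ j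
... | yes i≡j = i≡j
... | no  i≢j rewrite δ-≢ i≢j = contradiction 1≤δ n≮0

-- In type C_n the letter j+1 has weight Λ_{j+1} − Λ_j and its bar Λ_j − Λ_{j+1}.
module _ (n : ℕ) {i j : ℕ} (j<n : j < n) where
  private
    open module L = Let n i
    φ-source : ∀ {l l′} → Arrow n i l l′ → φ l ≡ 1
    φ-source a rewrite Arrow⇒fLet n a = refl
    ε-target : ∀ {l l′} → Arrow n i l l′ → ε l′ ≡ 1
    ε-target a rewrite Arrow⇒eLet n a = refl
    φ-none : ∀ l → (∀ {l′} → ¬ Arrow n i l l′) → φ l ≡ 0
    φ-none l ¬a with fLet n (suc i) l in eq
    ... | nothing = refl
    ... | just l′ = contradiction (fLet⇒Arrow n l eq) ¬a
    ε-none : ∀ l → (∀ {l′} → ¬ Arrow n i l′ l) → ε l ≡ 0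
    ε-none l ¬a with eLet n (suc i) l in eq
    ... | nothing = refl
    ... | just l′ = contradiction (eLet⇒Arrow n l eq) ¬a

  φ-ub : φ (ub (suc j)) ≡ δ (suc i) (suc j)
  φ-ub with i ≟ j
  ... | no i≢j = trans (φ-none (ub (suc j)) λ { (up _) → i≢j refl ; (turn _) → i≢j refl }) (sym (δ-≢ i≢j))
  ... | yes refl with m≤n⇒m<n∨m≡n j<n
  ...   | inj₁ i<n = trans (φ-source (up i<n)) (sym (δ-refl i))
  ...   | inj₂ i≡n = trans (φ-source (turn i≡n)) (sym (δ-refl i))

  ε-ub : ε (ub (suc j)) ≡ δ (suc i) j
  ε-ub with suc i ≟ j
  ... | no i≢j   = trans (ε-none (ub (suc j)) λ { (up _) → i≢j refl }) (sym (δ-≢ i≢j))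
  ... | yes refl = trans (ε-target (up j<n)) (sym (δ-refl i))

  φ-br : φ (br (suc j)) ≡ δ (suc i) j
  φ-br with suc i ≟ j
  ... | no i≢j   = trans (φ-none (br (suc j)) λ { (dn _) → i≢j refl }) (sym (δ-≢ i≢j))
  ... | yes refl = trans (φ-source (dn j<n)) (sym (δ-refl i))

  ε-br : ε (br (suc j)) ≡ δ (suc i) (suc j)
  ε-br with i ≟ j
  ... | no i≢j = trans (ε-none (br (suc j)) λ { (dn _) → i≢j refl ; (turn _) → i≢j refl }) (sym (δ-≢ i≢j))
  ... | yes refl with m≤n⇒m<n∨m≡n j<n
  ...   | inj₁ i<n = trans (ε-target (dn i<n)) (sym (δ-refl i))
  ...   | inj₂ i≡n = trans (ε-target (turn i≡n)) (sym (δ-refl i))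

-- Words, columns and the operators of index 0.

word-seminormal : ∀ n k i → Seminormal (wordC n k) i
word-seminormal n zero    i = unit-seminormal
word-seminormal n (suc k) i =
  Tensor.seminormal (cons-tensor (letC n) (wordC n k)) (letter-seminormal n i) (word-seminormal n k i)

cnt : (Letter → Bool) → Vec Letter k → ℕ
cnt p []       = 0
cnt p (l ∷ ls) = (if p l then 1 else 0) + cnt p ls

cnt≤length : ∀ p (ls : Vec Letter k) → cnt p ls ≤ k
cnt≤length p []       = z≤n
cnt≤length p (l ∷ ls) with p l
... | true  = s≤s (cnt≤length p ls)
... | false = m≤n⇒m≤1+n (cnt≤length p ls)

cnt-∷ʳ : ∀ p (ls : Vec Letter k) l → cnt p (ls ∷ʳ l) ≡ cnt p (l ∷ ls)
cnt-∷ʳ p []        l = refl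
cnt-∷ʳ p (l′ ∷ ls) l = trans (cong ((if p l′ then 1 else 0) +_) (cnt-∷ʳ p ls l))
  (trans (sym (+-assoc (if p l′ then 1 else 0) _ _))
  (trans (cong (_+ cnt p ls) (+-comm (if p l′ then 1 else 0) _)) (+-assoc (if p l then 1 else 0) _ _)))

cnt-reverse : ∀ p (ls : Vec Letter k) → cnt p (reverse ls) ≡ cnt p ls
cnt-reverse p []       = refl
cnt-reverse p (l ∷ ls) = trans (cong (cnt p) (reverse-∷ l ls))
  (trans (cnt-∷ʳ p (reverse ls) l) (cong ((if p l then 1 else 0) +_) (cnt-reverse p ls)))

removeL-∅ : ∀ p (ls : Vec Letter (suc k)) → removeL p ls ≡ nothing → cnt p ls ≡ 0
removeL-∅ {zero}  p (l ∷ []) eq with p l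
... | false = refl
removeL-∅ {suc k} p (l ∷ ls) eq with p l
... | false = removeL-∅ p ls (map-nothing⁻ eq)

-- All predicates are treated at once because the operators of index 0 change the numbers of 1 and
-- of its bar together.
removeL-cnt : ∀ p (ls : Vec Letter (suc k)) {ls′} → removeL p ls ≡ just ls′ →
  ∃ λ l → p l ≡ true × (∀ q → cnt q ls ≡ cnt q (l ∷ ls′))
removeL-cnt {zero}  p (l ∷ []) eq with p l in pl
removeL-cnt {zero}  p (l ∷ []) refl | true = l , pl , λ q → refl
removeL-cnt {suc k} p (l ∷ ls) eq with p l in pl
removeL-cnt {suc k} p (l ∷ ls) refl | true = l , pl , λ q → refl
... | false with ls′ , eq′ , refl ← map-just⁻ (l ∷_) (removeL p ls) eq
  with l₀ , pl₀ , cnt-≡ ← removeL-cnt p ls eq′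
  = l₀ , pl₀ , λ q → trans (cong ((if q l then 1 else 0) +_) (cnt-≡ q))
      (trans (sym (+-assoc (if q l then 1 else 0) _ _))
      (trans (cong (_+ cnt q ls′) (+-comm (if q l then 1 else 0) _)) (+-assoc (if q l₀ then 1 else 0) _ _)))

removeL-All : ∀ {P : Letter → Set} p (ls : Vec Letter (suc k)) {ls′} → removeL p ls ≡ just ls′ →
  Allᵛ P ls → Allᵛ P ls′
removeL-All {zero}  p (l ∷ []) eq (_ ∷ []) with p l
removeL-All {zero}  p (l ∷ []) refl (_ ∷ []) | true = []
removeL-All {suc k} p (l ∷ ls) eq (Pl ∷ Pls) with p l
removeL-All {suc k} p (l ∷ ls) refl (Pl ∷ Pls) | true = Pls
... | false with ls′ , eq′ , refl ← map-just⁻ (l ∷_) (removeL p ls) eq = Pl ∷ removeL-All p ls eq′ Pls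

removeL-∷ʳ : ∀ p (ls : Vec Letter k) {l} → p l ≡ true → cnt p ls ≡ 0 → removeL p (ls ∷ʳ l) ≡ just ls
removeL-∷ʳ p []       pl _ rewrite pl = refl
removeL-∷ʳ p (l ∷ ls) pl z with p l
... | false = cong-map-just (removeL-∷ʳ p ls pl z)

-- On arbitrary words an arrow of index 0 trades one bar of 1 for one letter 1, so the string
-- lengths count these letters.
column₀-seminormal : ∀ n r → Seminormal (colC n r) 0
column₀-seminormal n r = record
  { ε = cnt isOne ; φ = cnt isBar1
  ; ε-bound = cnt≤length isOne ; φ-bound = cnt≤length isBar1
  ; e-∅ = e-∅ ; e-step = e-step ; f-∅ = f-∅ ; f-step = f-step }
  where
  e-∅ : ∀ {r} {x : Vec Letter r} → e0Col x ≡ nothing → cnt isOne x ≡ 0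
  e-∅ {x = []}     _  = refl
  e-∅ {x = l ∷ ls} eq = removeL-∅ isOne (l ∷ ls) (map-nothing⁻ eq)

  f-∅ : ∀ {r} {x : Vec Letter r} → f0Col x ≡ nothing → cnt isBar1 x ≡ 0
  f-∅ {x = []}     _  = refl
  f-∅ {x = l ∷ ls} eq = removeL-∅ isBar1 (l ∷ ls) (map-nothing⁻ eq)

  isOne⇒¬isBar1 : ∀ l → isOne l ≡ true → isBar1 l ≡ false
  isOne⇒¬isBar1 (ub _) _ = refl

  isBar1⇒¬isOne : ∀ l → isBar1 l ≡ true → isOne l ≡ false
  isBar1⇒¬isOne (br _) _ = refl

  e-step : ∀ {r} {x x′ : Vec Letter r} → e0Col x ≡ just x′ →
    cnt isOne x ≡ suc (cnt isOne x′) × cnt isBar1 x′ ≡ suc (cnt isBar1 x)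
  e-step {x = x@(_ ∷ _)} eq with v , eq′ , refl ← map-just⁻ (_∷ʳ br 1) (removeL isOne x) eq
    with l , one , cnt-≡ ← removeL-cnt isOne x eq′
    rewrite cnt-∷ʳ isOne v (br 1) | cnt-∷ʳ isBar1 v (br 1) | cnt-≡ isOne | cnt-≡ isBar1
          | one | isOne⇒¬isBar1 l one = refl , refl

  f-step : ∀ {r} {x x′ : Vec Letter r} → f0Col x ≡ just x′ →
    cnt isBar1 x ≡ suc (cnt isBar1 x′) × cnt isOne x′ ≡ suc (cnt isOne x)
  f-step {x = x@(_ ∷ _)} eq with v , eq′ , refl ← map-just⁻ (ub 1 ∷_) (removeL isBar1 x) eq
    with l , bar , cnt-≡ ← removeL-cnt isBar1 x eq′
    rewrite cnt-≡ isOne | cnt-≡ isBar1 | bar | isBar1⇒¬isOne l bar = refl , refl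

column-seminormal : ∀ n r i → Seminormal (colC n r) i
column-seminormal n r zero    = column₀-seminormal n r
column-seminormal n r (suc i) = record
  { ε = ε ∘ reverse ; φ = φ ∘ reverse
  ; ε-bound = λ x → subst (ε (reverse x) ≤_) (bound-word r) (ε-bound (reverse x))
  ; φ-bound = λ x → subst (φ (reverse x) ≤_) (bound-word r) (φ-bound (reverse x))
  ; e-∅    = λ {x} eq → e-∅ {reverse x} (map-nothing⁻ eq)
  ; f-∅    = λ {x} eq → f-∅ {reverse x} (map-nothing⁻ eq)
  ; e-step = λ {x} {x′} → on-reversed {P = λ w w′ → ε w ≡ suc (ε w′) × φ w′ ≡ suc (φ w)} e-step {x} {x′}
  ; f-step = λ {x} {x′} → on-reversed {P = λ w w′ → φ w ≡ suc (φ w′) × ε w′ ≡ suc (ε w)} f-step {x} {x′} }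
  where
  open Seminormal (word-seminormal n r (suc i))
  bound-word : ∀ k → bound (wordC n k) ≡ k
  bound-word zero    = refl
  bound-word (suc k) = cong suc (bound-word k)
  on-reversed : ∀ {g : Vec Letter r → Maybe (Vec Letter r)} {P : Vec Letter r → Vec Letter r → Set} →
    (∀ {w w′} → g w ≡ just w′ → P w w′) →
    ∀ {x x′} → Maybe.map reverse (g (reverse x)) ≡ just x′ → P (reverse x) (reverse x′)
  on-reversed {g} {P} g-P {x} eq with w , eq′ , refl ← map-just⁻ reverse (g (reverse x)) eq
    = subst (P (reverse x)) (sym (reverse-involutive w)) (g-P eq′)

FMax-column : ∀ {n r i x w} → FMax (word-seminormal n r (suc i)) (reverse x) w →
  FMax (column-seminormal n r (suc i)) x (reverse w)
FMax-column {n} {r} {i} {x} {w} (fmax run end) = fmax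
  (subst (λ x → Run _ x (reverse w)) (reverse-involutive x)
    (mapᴿ (λ _ → ⊤) reverse
      (λ {w₁} z eq → cong-map-just (trans (cong (f (wordC n r) (suc i)) (reverse-involutive w₁)) eq) , z)
      tt run))
  (trans (cong φ (reverse-involutive w)) end)
  where open Seminormal (word-seminormal n r (suc i))

tens-seminormal : ∀ n rs i → Seminormal (tensC n rs) i
tens-seminormal n []       i = unit-seminormal
tens-seminormal n (r ∷ rs) i = Tensor.seminormal (⊗-tensor (colC n r) (tensC n rs))
  (column-seminormal n r i) (tens-seminormal n rs i)

All-∷ʳ : ∀ {ls : Vec Letter k} {l} → Allᵛ P ls → P l → Allᵛ P (ls ∷ʳ l)
All-∷ʳ []         Pl = Pl ∷ []
All-∷ʳ (Pm ∷ Pms) Pl = Pm ∷ All-∷ʳ Pms Pl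

All-reverse : ∀ {ls : Vec Letter k} → Allᵛ P ls → Allᵛ P (reverse ls)
All-reverse []                     = []
All-reverse {ls = l ∷ ls} (Pl ∷ Pls) = subst (Allᵛ _) (sym (reverse-∷ l ls)) (All-∷ʳ (All-reverse Pls) Pl)

cnt-none : ∀ p → (∀ {l} → P l → p l ≡ false) → {ls : Vec Letter k} → Allᵛ P ls → cnt p ls ≡ 0
cnt-none p ¬p []         = refl
cnt-none p ¬p (Pl ∷ Pls) rewrite ¬p Pl = cnt-none p ¬p Pls

-- Letters during a round.

module Rounds (n : ℕ) where

  LetterMax : ℕ → Letter → Letter → Set
  LetterMax i = FMax (letter-seminormal n i)

  WordMax ColumnMax : ℕ → Vec Letter k → Vec Letter k → Set
  WordMax   i = FMax (word-seminormal n _ i)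
  ColumnMax i = FMax (column-seminormal n _ i)

  TensMax : ∀ rs → ℕ → Tens rs → Tens rs → Set
  TensMax rs i = FMax (tens-seminormal n rs i)

  εˡ φˡ : ℕ → Letter → ℕ
  εˡ i = Seminormal.ε (letter-seminormal n i)
  φˡ i = Seminormal.φ (letter-seminormal n i)

  εʷ φʷ εᶜ φᶜ : ℕ → Vec Letter k → ℕ
  εʷ i = Seminormal.ε (word-seminormal n _ i)
  φʷ i = Seminormal.φ (word-seminormal n _ i)
  εᶜ i = Seminormal.ε (column-seminormal n _ i)
  φᶜ i = Seminormal.φ (column-seminormal n _ i)

  εᵗ φᵗ : ∀ rs → ℕ → Tens rs → ℕ
  εᵗ rs i = Seminormal.ε (tens-seminormal n rs i)
  φᵗ rs i = Seminormal.φ (tens-seminormal n rs i)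

  module _ {k i : ℕ} where
    open Tensor (cons-tensor (letC n) (wordC n k)) (letter-seminormal n i) (word-seminormal n k i) public
      using () renaming (fmax-⊗ to fmax-∷)

  ε-∷ : ∀ i l (w : Vec Letter k) → εˡ i l ≡ 0 → εʷ i (l ∷ w) ≡ εʷ i w
  ε-∷ i l w εl rewrite εl | 0∸n≡0 (φʷ i w) = +-identityʳ _

  -- Letters with ε_i = 0 do not obstruct each other, so f_i^max acts letter by letter.
  word-step : (∀ {l} → P l → ∃ λ l′ → LetterMax i l l′ × Q l′ × εˡ i l ≡ 0) →
    {w : Vec Letter k} → Allᵛ P w → ∃ λ w′ → WordMax i w w′ × Allᵛ Q w′ × εʷ i w ≡ 0
  word-step letter-step []                  = [] , fmax [] refl , [] , refl
  word-step letter-step {w = l ∷ w} (Pl ∷ Pw)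
    with l′ , max , Ql , εl ← letter-step Pl
       | w′ , maxʷ , Qw , εw ← word-step letter-step Pw
    = l′ ∷ w′ , fmax-∷ εl max maxʷ , Ql ∷ Qw , trans (ε-∷ _ l w εl) εw

  -- Letters that may occur, just before f_i^max, in a column that had no bars when the round began.
  data Rotating (i : ℕ) : Letter → Set where
    ub : j < n → j ≢ i → Rotating i (ub (suc j))
    br : i < n → Rotating i (br (suc i))

  -- Among unbarred letters only i + 2 has ε_{i+1} > 0, and it is excluded. Applying f_{i+1} then
  -- removes the letter i + 1, which is the exclusion for the next index down.
  rotate : ∀ {l} → Rotating (suc i) l → ∃ λ l′ → LetterMax (suc i) l l′ × Rotating i l′ × εˡ (suc i) l ≡ 0
  rotate {i} (ub {j} j<n j≢i+1) with ε0 ← trans (ε-ub n j<n) (δ-≢ (j≢i+1 ∘ sym)) | j ≟ i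
  ... | no j≢i = _ , fmax-refl _ (trans (φ-ub n j<n) (δ-≢ (j≢i ∘ sym))) , ub j<n j≢i , ε0
  ... | yes refl with m≤n⇒m<n∨m≡n j<n
  ...   | inj₁ i+1<n = _ , Arrow⇒FMax n (up i+1<n) , ub i+1<n 1+n≢n , ε0
  ...   | inj₂ i+1≡n = _ , Arrow⇒FMax n (turn i+1≡n) , br j<n , ε0
  rotate {i} (br i+1<n) = _ , Arrow⇒FMax n (dn i+1<n) , br (<-trans (n<1+n i) i+1<n)
    , trans (ε-br n {i} {suc i} i+1<n) (δ-≢ {suc i} {suc (suc i)} (1+n≢n ∘ sym))

  -- Letters j+1 of the initial part {1, …, k} of the working column, which becomes {2, …, k+1}
  -- in the course of the round.
  data Low (k i : ℕ) : Letter → Set where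
    low : j ≤ k → j ≢ i → (k ≤ i → j < k) → Low k i (ub (suc j))

  -- Only the letter i + 1 can move, and its presence forces i < k, so its successor is still at
  -- most k + 1.
  low-step : k < n → ∀ {l} → Low k (suc i) l →
    ∃ λ l′ → LetterMax (suc i) l l′ × Low k i l′ × εˡ (suc i) l ≡ 0
  low-step {k} {i} k<n (low {j} j≤k j≢i+1 bnd)
    with ε0 ← trans (ε-ub n (≤-<-trans j≤k k<n)) (δ-≢ (j≢i+1 ∘ sym)) | j ≟ i
  ... | no j≢i = _ , fmax-refl _ (trans (φ-ub n (≤-<-trans j≤k k<n)) (δ-≢ (j≢i ∘ sym)))
      , low j≤k j≢i (bnd ∘ m≤n⇒m≤1+n) , ε0
  ... | yes refl = _ , Arrow⇒FMax n (up (≤-<-trans i<k k<n)) , low i<k 1+n≢n (λ k≤i → contradiction k≤i (<⇒≱ i<k)) , ε0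
    where
    i<k : j < k
    i<k with ≤-<-connex k j
    ... | inj₁ k≤i = bnd (m≤n⇒m≤1+n k≤i)
    ... | inj₂ i<k = i<k

  -- While the index i + 1 exceeds k, all letters are at most k, so neither i + 1 nor i + 2 occurs.
  low-inert : k < n → k ≤ i → {w : Vec Letter m} → Allᵛ (Low k (suc i)) w → εʷ (suc i) w ≡ 0 × φʷ (suc i) w ≡ 0
  low-inert k<n k≤i [] = refl , refl
  low-inert {i = i} k<n k≤i {w = l ∷ w} (low {j} j≤k j≢i+1 bnd ∷ lows)
    with εw , φw ← low-inert k<n k≤i lows
    = trans (ε-∷ _ l w ε0) εw , cong₂ _+_ φ0 (trans (cong (_∸ εˡ (suc i) l) φw) (0∸n≡0 (εˡ (suc i) l)))
    where
    ε0 = trans (ε-ub n (≤-<-trans j≤k k<n)) (δ-≢ (j≢i+1 ∘ sym))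
    φ0 = trans (φ-ub n (≤-<-trans j≤k k<n)) (δ-≢ (<⇒≢ (<-≤-trans (bnd (m≤n⇒m≤1+n k≤i)) k≤i) ∘ sym ∘ suc-injective))

  low-next : k ≤ i → ∀ {l} → Low k (suc i) l → Low k i l
  low-next k≤i (low j≤k _ bnd) =
    low j≤k (<⇒≢ (<-≤-trans (bnd (m≤n⇒m≤1+n k≤i)) k≤i)) (λ _ → bnd (m≤n⇒m≤1+n k≤i))

  -- Shapes of columns and their string lengths.

  data Falling (P : Letter → Set) (a : ℕ) : ℕ → Vec Letter k → Set where
    stop : {w : Vec Letter k} → Allᵛ P w → Falling P a a w
    ub   : {w : Vec Letter k} → c < n → Falling P a c w → Falling P a (suc c) (ub (suc c) ∷ w)

  -- Words are columns read from the largest letter: the bars of b+1, …, c, then c, …, a+1, then letters in P.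
  data Rising (P : Letter → Set) (a c : ℕ) : ℕ → Vec Letter k → Set where
    stop : {w : Vec Letter k} → Falling P a c w → Rising P a c c w
    br   : {w : Vec Letter k} → b < n → Rising P a c (suc b) w → Rising P a c b (br (suc b) ∷ w)

  falling-≤ : {w : Vec Letter k} → Falling P a c w → a ≤ c
  falling-≤ (stop _) = ≤-refl
  falling-≤ (ub _ w) = m≤n⇒m≤1+n (falling-≤ w)

  rising-≤ : {w : Vec Letter k} → Rising P a c b w → b ≤ c
  rising-≤ (stop _) = ≤-refl
  rising-≤ (br _ w) = <⇒≤ (rising-≤ w)

  rising-map : (∀ {l} → P l → Q l) → {w : Vec Letter k} → Rising P a c b w → Rising Q a c b w
  rising-map P⇒Q (br b<n w) = br b<n (rising-map P⇒Q w)
  rising-map {P} {Q} {a = a} P⇒Q (stop w) = stop (go w)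
    where
    go : {w : Vec Letter k} → Falling P a c w → Falling Q a c w
    go (stop Pw)  = stop (Allᵛ.map P⇒Q Pw)
    go (ub c<n w) = ub c<n (go w)

  rising-∷ʳ : ∀ {l} → P l → {w : Vec Letter k} → Rising P a c b w → Rising P a c b (w ∷ʳ l)
  rising-∷ʳ Pl (br b<n w) = br b<n (rising-∷ʳ Pl w)
  rising-∷ʳ {P} {a = a} {l = l} Pl (stop w) = stop (go w)
    where
    go : {w : Vec Letter k} → Falling P a c w → Falling P a c (w ∷ʳ l)
    go (stop Pw)  = stop (All-∷ʳ Pw Pl)
    go (ub c<n w) = ub c<n (go w)

  -- w ⊗ u_{Λ_a} is annihilated by e_i and has weight Λ_b as far as the index i is concerned.
  record Lifts (i a b : ℕ) (w : Vec Letter k) : Set where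
    constructor lifts
    field
      ε-≤ : εʷ i w ≤ δ i a
      φ-≡ : φʷ i w + (δ i a ∸ εʷ i w) ≡ δ i b

  -- The ε_i of the new letter equals φ_i(w ⊗ u_{Λ_a}) = δ_ib: the part beyond φ_i(w) is absorbed by
  -- u_{Λ_a}, and no φ_i of w survives.
  lifts-∷ : ∀ i l (w : Vec Letter k) {b b′} → εˡ i l ≡ δ i b → φˡ i l ≡ δ i b′ → Lifts i a b w → Lifts i a b′ (l ∷ w)
  lifts-∷ {a = a} i l w {b} {b′} εl φl (lifts ε≤ φ+) = lifts (≤-reflexive ε′≡)
    (trans (cong₂ _+_ φ′≡ (m≤n⇒m∸n≡0 (≤-reflexive (sym ε′≡)))) (+-identityʳ (δ i b′)))
    where
    εl≡ : εˡ i l ≡ φʷ i w + (δ i a ∸ εʷ i w)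
    εl≡ = trans εl (sym φ+)
    ε′≡ : εʷ i w + (εˡ i l ∸ φʷ i w) ≡ δ i a
    ε′≡ = trans (cong (εʷ i w +_) (trans (cong (_∸ φʷ i w) εl≡) (m+n∸m≡n (φʷ i w) _))) (m+[n∸m]≡n ε≤)
    φ′≡ : φˡ i l + (φʷ i w ∸ εˡ i l) ≡ δ i b′
    φ′≡ = trans (cong₂ _+_ φl (m≤n⇒m∸n≡0 (≤-trans (m≤m+n (φʷ i w) _) (≤-reflexive (sym εl≡)))))
      (+-identityʳ (δ i b′))

  -- Starting from u_{Λ_a}, the letters a + 1, ..., c climb through the weights Λ_{a+1}, ..., Λ_c,
  -- and the bars of c, ..., b + 1 descend again to Λ_b.
  lifts-rising : (∀ {k} {w : Vec Letter k} → Allᵛ P w → εʷ (suc i) w ≡ 0 × φʷ (suc i) w ≡ 0) →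
    {w : Vec Letter k} → Rising P a c b w → Lifts (suc i) a b w
  lifts-rising {P} {i = i} {a = a} P-inert = go
    where
    go-falling : {w : Vec Letter k} → Falling P a c w → Lifts (suc i) a c w
    go-falling (stop Pw) with εw , φw ← P-inert Pw =
      lifts (subst (_≤ δ (suc i) a) (sym εw) z≤n) (cong₂ (λ e p → p + (δ (suc i) a ∸ e)) εw φw)
    go-falling {w = l ∷ w} (ub {c = c} c<n w∈) = lifts-∷ (suc i) l w {c} {suc c} (ε-ub n c<n) (φ-ub n c<n) (go-falling w∈)
    go : {w : Vec Letter k} → Rising P a c b w → Lifts (suc i) a b w
    go (stop w)   = go-falling w
    go {w = l ∷ w} (br {b = b} b<n w∈) = lifts-∷ (suc i) l w {suc b} {b} (ε-br n b<n) (φ-br n b<n) (go w∈)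

  -- Both summands in `φ-≡` vanish: the first is φ_i(w), and the second vanishes only if ε_i(w) is
  -- at least δ_ia.
  lifts-≢ : (w : Vec Letter k) → i ≢ b → Lifts i a b w → εʷ i w ≡ δ i a × φʷ i w ≡ 0
  lifts-≢ {i = i} w i≢b (lifts ε≤ φ+) =
    ≤-antisym ε≤ (m∸n≡0⇒m≤n (m+n≡0⇒n≡0 (φʷ i w) (trans φ+ (δ-≢ i≢b)))) ,
    m+n≡0⇒m≡0 (φʷ i w) (trans φ+ (δ-≢ i≢b))

  low-lifts : k < n → k ≤ i → {w : Vec Letter m} → Rising (Low k (suc i)) a c b w → Lifts (suc i) a b w
  low-lifts k<n k≤i = lifts-rising (low-inert k<n k≤i)

  falling-move : k < n → suc i < a → {w : Vec Letter m} → Falling (Low k (suc i)) a c w →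
    ∃ λ w′ → WordMax (suc i) w w′ × Falling (Low k i) a c w′ × εʷ (suc i) w ≡ 0
  falling-move k<n i+1<a (stop lows) with w′ , max , lows′ , εw ← word-step (low-step k<n) lows
    = w′ , max , stop lows′ , εw
  falling-move k<n i+1<a {w = l ∷ w} (ub c<n falling)
    with w′ , max , falling′ , εw ← falling-move k<n i+1<a falling | i+1<c ← <-≤-trans i+1<a (falling-≤ falling)
    with ε0 ← trans (ε-ub n c<n) (δ-≢ (<⇒≢ i+1<c))
    = l ∷ w′ , fmax-∷ ε0 (fmax-refl _ (trans (φ-ub n c<n) (δ-≢ (<⇒≢ (m<n⇒m<1+n i+1<c))))) max
    , ub c<n falling′ , trans (ε-∷ _ l w ε0) εw

  -- An index below both a and b meets none of the fixed letters, so only the low letters move.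
  rising-move : k < n → suc i < a → suc i < b → {w : Vec Letter m} → Rising (Low k (suc i)) a c b w →
    ∃ λ w′ → WordMax (suc i) w w′ × Rising (Low k i) a c b w′ × εʷ (suc i) w ≡ 0
  rising-move k<n i+1<a i+1<b (stop falling) with w′ , max , falling′ , εw ← falling-move k<n i+1<a falling
    = w′ , max , stop falling′ , εw
  rising-move k<n i+1<a i+1<b {w = l ∷ w} (br b<n rising)
    with w′ , max , rising′ , εw ← rising-move k<n i+1<a (m<n⇒m<1+n i+1<b) rising
    with ε0 ← trans (ε-br n b<n) (δ-≢ (<⇒≢ (m<n⇒m<1+n i+1<b)))
    = l ∷ w′ , fmax-∷ ε0 (fmax-refl _ (trans (φ-br n b<n) (δ-≢ (<⇒≢ i+1<b)))) max
    , br b<n rising′ , trans (ε-∷ _ l w ε0) εw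

  -- The inequality k < a keeps two regimes apart. If i + 1 is at least a, it exceeds k, the low
  -- letters are inert and the column lifts Λ_a; if i + 1 < a, the fixed letters are inert and
  -- δ_{i+1,a} = 0.
  rising-step : k < n → k < a → i < b → {w : Vec Letter m} → Rising (Low k (suc i)) a c (suc b) w →
    ∃ λ w′ → WordMax (suc i) w w′ × Rising (Low k i) a c (suc b) w′ × εʷ (suc i) w ≡ δ (suc i) a
  rising-step {k} {a} {i} k<n k<a i<b {w} rising with ≤-<-connex a (suc i)
  ... | inj₁ a≤i+1
    with εw , φw ← lifts-≢ {a = a} w (<⇒≢ (s≤s i<b)) (low-lifts k<n (≤-pred (≤-trans k<a a≤i+1)) rising)
    = w , fmax-refl _ φw , rising-map (low-next (≤-pred (≤-trans k<a a≤i+1))) rising , εw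
  ... | inj₂ i+1<a
    with w′ , max , rising′ , εw ← rising-move k<n i+1<a (s≤s i<b) rising
    = w′ , max , rising′ , trans εw (sym (δ-≢ (<⇒≢ i+1<a)))

  -- The working column, read as a word, just before f_i^max: its largest letter is the bar of b+1
  -- until i = b, and from then on the bar of i+1.
  data Working (k a c b i : ℕ) : Vec Letter m → Set where
    working : ∀ {h} {w : Vec Letter m} → (b ≤ i × h ≡ b) ⊎ (i < b × h ≡ i) →
      Rising (Low k i) a c (suc b) w → Working k a c b i (br (suc h) ∷ w)

  working-move : k < a → k ≤ b → b < n → i < b → {w : Vec Letter m} → Rising (Low k (suc i)) a c (suc b) w →
    ∃ λ w′ → WordMax (suc i) (br (suc (suc i)) ∷ w) w′ × Working k a c b i w′ ×
             εʷ (suc i) (br (suc (suc i)) ∷ w) ≡ δ (suc i) a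
  working-move {i = i} k<a k≤b b<n i<b {w} rising
    with w′ , max , rising′ , εw ← rising-step (≤-<-trans k≤b b<n) k<a i<b rising
    with i+1<n ← ≤-<-trans i<b b<n
    with ε0 ← trans (ε-br n {i} {suc i} i+1<n) (δ-≢ {suc i} {suc (suc i)} (1+n≢n ∘ sym))
    = _ , fmax-∷ ε0 (Arrow⇒FMax n (dn i+1<n)) max , working (inj₂ (i<b , refl)) rising′
    , trans (ε-∷ _ (br (suc (suc i))) w ε0) εw

  working-step : k < a → k ≤ b → b < n → {w : Vec Letter m} → Working k a c b (suc i) w →
    ∃ λ w′ → WordMax (suc i) w w′ × Working k a c b i w′ × εʷ (suc i) w ≡ δ (suc i) a
  working-step k<a k≤b b<n (working (inj₂ (i+1<b , refl)) rising) =
    working-move k<a k≤b b<n (<-trans (n<1+n _) i+1<b) rising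
  working-step {a = a} k<a k≤b b<n {w} (working (inj₁ (b≤i+1 , refl)) rising) with m≤n⇒m<n∨m≡n b≤i+1
  -- At index b the bar of b + 1 sets off.
  ... | inj₂ refl = working-move k<a k≤b b<n (n<1+n _) rising
  -- An index above b is also above k, so the low letters are inert and φ vanishes on the column:
  -- nothing moves.
  ... | inj₁ (s≤s b≤i)
    with εw , φw ← lifts-≢ {a = a} w (<⇒≢ (s≤s b≤i) ∘ sym)
                     (low-lifts (≤-<-trans k≤b b<n) (≤-trans k≤b b≤i) (br b<n rising))
    = w , fmax-refl _ φw , working (inj₁ (b≤i , refl)) (rising-map (low-next (≤-trans k≤b b≤i)) rising) , εw

  -- Effect of a round on whole columns.

  All-unreverse : {x : Vec Letter k} → Allᵛ P (reverse x) → Allᵛ P x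
  All-unreverse {x = x} Px = subst (Allᵛ _) (reverse-involutive x) (All-reverse Px)

  Rotates : (i i′ : ℕ) → Set
  Rotates i i′ = ∀ {r} {z : Vec Letter r} → Allᵛ (Rotating i) z →
    ∃ λ z′ → ColumnMax i z z′ × Allᵛ (Rotating i′) z′ × εᶜ i z ≡ 0

  rotate-column : Rotates (suc i) i
  rotate-column {i} {z = z} rot with w , max , rot′ , ε0 ← word-step rotate (All-reverse rot)
    = reverse w , FMax-column {x = z} max , All-reverse rot′ , ε0

  -- Invariant under f_0, unlike `Rotating 0`, which excludes the letter 1 that f_0 inserts.
  data UnbarredOr1̄ : Letter → Set where
    ub : j < n → UnbarredOr1̄ (ub (suc j))
    br : UnbarredOr1̄ (br 1)

  rotating₀⇒ : ∀ {l} → Rotating 0 l → UnbarredOr1̄ l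
  rotating₀⇒ (ub j<n _) = ub j<n
  rotating₀⇒ (br _)     = br

  f0-UnbarredOr1̄ : 0 < n → ∀ {r} {x x′ : Vec Letter r} → f0Col x ≡ just x′ → Allᵛ UnbarredOr1̄ x → Allᵛ UnbarredOr1̄ x′
  f0-UnbarredOr1̄ 0<n {x = x@(_ ∷ _)} eq Px with v , eq′ , refl ← map-just⁻ (ub 1 ∷_) (removeL isBar1 x) eq
    = ub 0<n ∷ removeL-All isBar1 x eq′ Px

  data Unbarred : Letter → Set where
    ub : j < n → Unbarred (ub (suc j))

  no-1̄ : {z : Vec Letter r} → Allᵛ UnbarredOr1̄ z → cnt isBar1 z ≡ 0 → Allᵛ Unbarred z
  no-1̄ []             _ = []
  no-1̄ (ub j<n ∷ Pz) z = ub j<n ∷ no-1̄ Pz z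

  unbarred⇒rotating : ∀ {l} → Unbarred l → Rotating n l
  unbarred⇒rotating (ub j<n) = ub j<n (<⇒≢ j<n)

  rotate-column₀ : 0 < n → Rotates 0 n
  rotate-column₀ 0<n rot
    with z′ , max , Pz′ ← fmax-exists (column-seminormal n _ 0) (Allᵛ UnbarredOr1̄) (f0-UnbarredOr1̄ 0<n)
                            (Allᵛ.map rotating₀⇒ rot)
    = z′ , max , Allᵛ.map unbarred⇒rotating (no-1̄ Pz′ (FMax.φ-end max))
    , cnt-none isOne (λ { (ub {zero} _ j≢0) → contradiction refl j≢0 ; (ub {suc j} _ _) → refl ; (br _) → refl }) rot

  -- The bars that occur belong to letters at least b + 2.
  rising-no-1̄ : (∀ {l} → P l → isBar1 l ≡ false) → {w : Vec Letter m} → Rising P a c (suc b) w → cnt isBar1 w ≡ 0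
  rising-no-1̄ ¬bar (br _ w) = rising-no-1̄ ¬bar w
  rising-no-1̄ {P} {a = a} ¬bar (stop w) = falling w
    where
    falling : ∀ {m c} {w : Vec Letter m} → Falling P a c w → cnt isBar1 w ≡ 0
    falling (stop Pw) = cnt-none isBar1 ¬bar Pw
    falling (ub _ w)  = falling w

  -- The travelling letter has become the bar of 1. Now f_0 turns it into 1, which joins the low
  -- letters, by then in 2, ..., k + 1, to form the low part of the next round.
  working-column₀ : k < n → {x : Vec Letter r} → Working k a c b 0 (reverse x) →
    ∃ λ x′ → ColumnMax 0 x x′ × Rising (Low (suc k) n) a c (suc b) (reverse x′)
  working-column₀ {k} {a = a} {c} {b} k<n {x} working₀ = go _ refl working₀
    where
    low₀ : ∀ {l} → Low k 0 l → Low (suc k) n l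
    low₀ (low j≤k _ _) = low (m≤n⇒m≤1+n j≤k) (<⇒≢ (≤-<-trans j≤k k<n)) (λ _ → s≤s j≤k)

    apply-f₀ : ∀ {m} (w : Vec Letter m) → Rising (Low k 0) a c (suc b) w →
      ∃ λ x′ → ColumnMax 0 (reverse (br 1 ∷ w)) x′ × Rising (Low (suc k) n) a c (suc b) (reverse x′)
    apply-f₀ w rising rewrite reverse-∷ (br 1) w
      = ub 1 ∷ reverse w
      , fmax (f₀-≡ (reverse w) (trans (cnt-reverse isBar1 w) (rising-no-1̄ (λ { (low _ _ _) → refl }) rising)) ∷ [])
             (trans (cnt-reverse isBar1 w) (rising-no-1̄ (λ { (low _ _ _) → refl }) rising))
      , subst (Rising _ a c _) (sym (trans (reverse-∷ (ub 1) (reverse w)) (cong (_∷ʳ ub 1) (reverse-involutive w))))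
          (rising-∷ʳ (low z≤n (<⇒≢ (≤-<-trans z≤n k<n)) (λ _ → s≤s z≤n)) (rising-map low₀ rising))
      where
      f₀-≡ : ∀ {m} (v : Vec Letter m) → cnt isBar1 v ≡ 0 → f0Col (v ∷ʳ br 1) ≡ just (ub 1 ∷ v)
      f₀-≡ []      z = refl
      f₀-≡ (l ∷ v) z = cong-map-just (removeL-∷ʳ isBar1 (l ∷ v) refl z)

    go : (w : Vec Letter _) → reverse x ≡ w → Working k a c b 0 w →
      ∃ λ x′ → ColumnMax 0 x x′ × Rising (Low (suc k) n) a c (suc b) (reverse x′)
    go (_ ∷ w) eq (working {h = h} hb rising) with h≡0 hb
      where
      h≡0 : (b ≤ 0 × h ≡ b) ⊎ (0 < b × h ≡ 0) → h ≡ 0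
      h≡0 (inj₁ (b≤0 , h≡b)) = trans h≡b (n≤0⇒n≡0 b≤0)
      h≡0 (inj₂ (_ , h≡0))   = h≡0
    ... | refl with x′ , max , rising′ ← apply-f₀ w rising
      = x′ , subst (λ x → ColumnMax 0 x x′) (trans (cong reverse (sym eq)) (reverse-involutive x)) max , rising′

  -- Ground states.

  -- A column u with ε(u) = Λ_a and φ(u) = Λ_b.
  record Column (a b : ℕ) (u : Vec Letter r) : Set where
    constructor column
    field
      {top}  : ℕ
      rising : Rising (λ _ → ⊥) a top b (reverse u)
      a≤n    : a ≤ n
      top-≤  : b < top → top ≤ a + b
      ε₀-≡   : cnt isOne u ≡ δ 0 a
      φ₀-≡   : cnt isBar1 u ≡ δ 0 b

  -- The first index counts columns and the second is the b with φ = Λ_b at the leftmost one.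
  -- Sharing a between neighbours encodes ε(u_{k+1}) = φ(u_k), and the empty product supplies Λ_0.
  data Ground : ℕ → ℕ → ∀ rs → Tens rs → Set where
    []  : Ground 0 0 [] tt
    _∷_ : {u : Vec Letter r} {t : Tens rs} → Column a b u → Ground m a rs t → Ground (suc m) b (r ∷ rs) (u , t)

  column-lifts : {u : Vec Letter r} → Column a b u → Lifts (suc i) a b (reverse u)
  column-lifts (column rising _ _ _ _) = lifts-rising (λ { [] → refl , refl ; (() ∷ _) }) rising

  -- Only an upper bound, since u_{Λ_0} is missing on the right. For i ≥ 1, inserting the bound for
  -- the right part turns the tensor formula into `φ-≡` for the leftmost column.
  ground-φ : ∀ i {t : Tens rs} → Ground m a rs t → φᵗ rs i t ≤ δ i a
  ground-φ i [] = z≤n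
  ground-φ zero {u , t} (col ∷ ground) = +-mono-≤ (≤-reflexive (Column.φ₀-≡ col))
    (≤-reflexive (m≤n⇒m∸n≡0 (≤-trans (ground-φ 0 ground) (≤-reflexive (sym (Column.ε₀-≡ col)))))) ⟨ ≤-trans ⟩
    ≤-reflexive (+-identityʳ _)
  ground-φ (suc i) {u , t} (col ∷ ground) with lifts ε≤ φ+ ← column-lifts {i = i} col =
    ≤-trans (+-monoʳ-≤ (φᶜ (suc i) u) (∸-monoˡ-≤ (εᶜ (suc i) u) (ground-φ (suc i) ground))) (≤-reflexive φ+)

  -- The rightmost column has ε_0 = 1, and factors added on the left cannot lower ε_0.
  ground-ε₀ : {t : Tens rs} → Ground (suc m) a rs t → 1 ≤ εᵗ rs 0 t
  ground-ε₀ (col ∷ [])              = ≤-reflexive (sym (Column.ε₀-≡ col))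
  ground-ε₀ (col ∷ ground@(_ ∷ _)) = ≤-trans (ground-ε₀ ground) (m≤m+n _ _)

  -- Demazure paths through one round.

  Path : ∀ rs → Tens rs → Tens rs → Set
  Path rs = DemazurePath n rs

  infixr 5 _⋯_
  _⋯_ : {t t′ t″ : Tens rs} → Path rs t t′ → Path rs t′ t″ → Path rs t t″
  done ⋯ q = q
  step i i≤n 0<φ 1≤ε eq p ⋯ q = step i i≤n 0<φ 1≤ε eq (p ⋯ q)

  -- Checking ε_0 ≥ 1 at the start suffices, because f_0 raises ε_0.
  run⇒path : i ≤ n → {t t′ : Tens rs} → (i ≡ 0 → 1 ≤ εᵗ rs 0 t) → Run (f (tensC n rs) i) t t′ → Path rs t t′
  run⇒path i≤n 1≤ε [] = done
  run⇒path {i} {rs} i≤n {t} 1≤ε (_∷_ {y = y} eq run) = step i i≤n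
    (subst (0 <_) (sym (trans (φC-exact S t) (proj₁ (f-step eq)))) (s≤s z≤n))
    (λ i≡0 → subst (1 ≤_) (sym (εC-exact (tens-seminormal n rs 0) t)) (1≤ε i≡0))
    eq (run⇒path i≤n (λ { refl → subst (1 ≤_) (sym (proj₂ (f-step eq))) (s≤s z≤n) }) run)
    where
    S = tens-seminormal n rs i
    open Seminormal S

  -- An element in mid-round: treated columns satisfying `Q`, then the working column satisfying
  -- `S`, then an untouched ground state of m columns.
  data Stage (Q : Letter → Set) (S : ∀ {r} → Vec Letter r → Set) (m a : ℕ) : ∀ rs → Tens rs → Set where
    _∷_  : {z : Vec Letter r} {t : Tens rs} → Allᵛ Q z → Stage Q S m a rs t → Stage Q S m a (r ∷ rs) (z , t)
    here : {x : Vec Letter r} {t : Tens rs} → S x → Ground m a rs t → Stage Q S m a (r ∷ rs) (x , t)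

  -- The treated columns have ε_i = 0 and let f_i pass to the right; the working column has ε_i at
  -- least δ_ia, which bounds φ_i of the ground state part and so shields it.
  stage-step : ∀ {i i′} {S S′ : ∀ {r} → Vec Letter r → Set} → Rotates i i′ →
    (∀ {r} {x : Vec Letter r} → S x → ∃ λ x′ → ColumnMax i x x′ × S′ x′ × δ i a ≤ εᶜ i x) →
    {t : Tens rs} → Stage (Rotating i) S m a rs t →
    ∃ λ t′ → TensMax rs i t t′ × Stage (Rotating i′) S′ m a rs t′
  stage-step {rs = r ∷ rs} {i = i} rotates works (rot ∷ stage)
    with z′ , max , rot′ , ε0 ← rotates rot
       | t′ , maxᵗ , stage′ ← stage-step rotates works stage
    = (z′ , t′) , Tensor.fmax-⊗ (⊗-tensor _ _) (column-seminormal n r i) (tens-seminormal n rs i) ε0 max maxᵗ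
    , rot′ ∷ stage′
  stage-step {rs = r ∷ rs} {i = i} rotates works (here {t = t} Sx ground)
    with x′ , max , Sx′ , δ≤ε ← works Sx
    = (x′ , t) , Tensor.fmax-shielded (⊗-tensor _ _) (column-seminormal n r i) (tens-seminormal n rs i)
                   (≤-trans (ground-φ i ground) δ≤ε) max
    , here Sx′ ground

  -- As a > 0, the ground state part is nonempty and contributes ε_0 ≥ 1.
  stage-ε₀ : ∀ {Q} {S : ∀ {r} → Vec Letter r → Set} {t : Tens rs} → 0 < a → Stage Q S m a rs t → 1 ≤ εᵗ rs 0 t
  stage-ε₀ 0<a (_ ∷ stage)                 = ≤-trans (stage-ε₀ 0<a stage) (m≤m+n _ _)
  stage-ε₀ 0<a (here _ ground@(_ ∷ _)) = ≤-trans (ground-ε₀ ground) (m≤m+n _ _)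

  stage-map : ∀ {Q} {S S′ : ∀ {r} → Vec Letter r → Set} → (∀ {r} {x : Vec Letter r} → S x → S′ x) →
    {t : Tens rs} → Stage Q S m a rs t → Stage Q S′ m a rs t
  stage-map h (rot ∷ stage)   = rot ∷ stage-map h stage
  stage-map h (here Sx ground) = here (h Sx) ground

  RisingColumn : (k a c b : ℕ) → Vec Letter r → Set
  RisingColumn k a c b x = Rising (Low k n) a c b (reverse x)

  module _ {k a b c : ℕ} (k<a : k < a) (k≤b : k ≤ b) (b<n : b < n) where

    WorkingColumn : ℕ → ∀ {r} → Vec Letter r → Set
    WorkingColumn i x = Working k a c b i (reverse x)

    working-column : ∀ {i r} {x : Vec Letter r} → WorkingColumn (suc i) x →
      ∃ λ x′ → ColumnMax (suc i) x x′ × WorkingColumn i x′ × δ (suc i) a ≤ εᶜ (suc i) x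
    working-column {i} {x = x} work with w′ , max , work′ , ε≡ ← working-step k<a k≤b b<n work
      = reverse w′ , FMax-column {x = x} max , subst (Working k a c b i) (sym (reverse-involutive w′)) work′
      , ≤-reflexive (sym ε≡)

    classical-steps : ∀ i → i ≤ n → {t : Tens rs} → Stage (Rotating i) (WorkingColumn i) m a rs t →
      ∃ λ t′ → Path rs t t′ × Stage (Rotating 0) (WorkingColumn 0) m a rs t′
    classical-steps zero    _   stage = _ , done , stage
    classical-steps {rs = rs} {m = m} (suc i) i<n stage
      with t′ , fmax run _ , stage′ ← stage-step {rs = rs} {m = m} rotate-column (λ {_} {x} → working-column {x = x}) stage
      with t″ , path , stage″ ← classical-steps i (<⇒≤ i<n) stage′
      = t″ , run⇒path i<n (λ ()) run ⋯ path , stage″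

    open-rising : b < c → {x : Vec Letter r} → RisingColumn k a c b x → WorkingColumn n x
    open-rising b<c {x} rising with reverse x
    open-rising b<c (stop _)      | _ = contradiction b<c (<-irrefl refl)
    open-rising b<c (br _ rising) | _ = working (inj₁ (<⇒≤ b<n , refl)) rising

    0<a : 0 < a
    0<a = ≤-<-trans z≤n k<a

    working-column₀-shielded : ∀ {r} {x : Vec Letter r} → WorkingColumn 0 x →
      ∃ λ x′ → ColumnMax 0 x x′ × RisingColumn (suc k) a c (suc b) x′ × δ 0 a ≤ εᶜ 0 x
    working-column₀-shielded {x = x} work with x′ , max , rising ← working-column₀ (≤-<-trans k≤b b<n) {x = x} work
      -- Since a > 0, δ_0a = 0, so the shielding bound is trivial at index 0.
      = x′ , max , rising , subst (_≤ cnt isOne x) (sym (δ-≢ (<⇒≢ 0<a))) z≤n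

    round : b < c → {t : Tens rs} → Stage (Rotating n) (RisingColumn k a c b) m a rs t →
      ∃ λ t′ → Path rs t t′ × Stage (Rotating n) (RisingColumn (suc k) a c (suc b)) m a rs t′
    round {rs} {m} b<c stage
      with t₀ , path , stage₀ ← classical-steps n ≤-refl
             (stage-map {S = RisingColumn k a c b} {WorkingColumn n} (λ {_} {x} → open-rising b<c {x}) stage)
      with t₁ , fmax run _ , stage₁ ← stage-step {rs = rs} {m = m} {S = WorkingColumn 0} {RisingColumn (suc k) a c (suc b)}
             (rotate-column₀ (≤-<-trans z≤n b<n)) (λ {_} {x} → working-column₀-shielded {x = x}) stage₀
      = t₁ , path ⋯ run⇒path z≤n (λ _ → stage-ε₀ 0<a stage₀) run , stage₁

  -- Iterating the rounds.

  data Ready (m : ℕ) : ∀ rs → Tens rs → Set where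
    _∷_    : {z : Vec Letter r} {t : Tens rs} → Allᵛ (Rotating n) z → Ready m rs t → Ready m (r ∷ rs) (z , t)
    ground : {t : Tens rs} → Ground m a rs t → Ready m rs t

  rising-unbarred : k ≤ n → {w : Vec Letter m} → Rising (Low k n) a c c w → Allᵛ (Rotating n) w
  rising-unbarred k≤n (br _ w) = contradiction (rising-≤ w) (<⇒≱ (n<1+n _))
  rising-unbarred {k} {a = a} k≤n (stop w) = go w
    where
    go : ∀ {m c} {w : Vec Letter m} → Falling (Low k n) a c w → Allᵛ (Rotating n) w
    go (stop lows) = Allᵛ.map (λ { (low _ j≢n j<k) → ub (<-≤-trans (j<k k≤n) k≤n) j≢n }) lows
    go (ub c<n w)  = ub c<n (<⇒≢ c<n) ∷ go w

  ready-unbarred : k ≤ n → {t : Tens rs} → Stage (Rotating n) (RisingColumn k a c c) m a rs t → Ready m rs t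
  ready-unbarred k≤n (rot ∷ stage)        = rot ∷ ready-unbarred k≤n stage
  ready-unbarred k≤n (here rising ground-t) = All-unreverse (rising-unbarred k≤n rising) ∷ ground ground-t

  -- k + j ≤ a is preserved: a round moves one letter from the bars to the low part.
  rounds : ∀ j → j + b ≡ c → c ≤ n → k ≤ b → k + j ≤ a → {t : Tens rs} →
    Stage (Rotating n) (RisingColumn k a c b) m a rs t → ∃ λ t′ → Path rs t t′ × Ready m rs t′
  rounds zero refl c≤n k≤b _ stage = _ , done , ready-unbarred (≤-trans k≤b c≤n) stage
  rounds {b} {k = k} {m = m} (suc j) refl c≤n k≤b k+j<a stage
    with b<c ← s≤s (m≤n+m b j)
    with t₁ , path , stage₁ ← round (≤-trans (≤-trans (s≤s (m≤m+n k j)) (≤-reflexive (sym (+-suc k j)))) k+j<a)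
                               k≤b (<-≤-trans b<c c≤n) b<c stage
    with t₂ , path′ , ready ← rounds {m = m} j (+-suc j b) c≤n (s≤s k≤b) (≤-trans (≤-reflexive (sym (+-suc k j))) k+j<a) stage₁
    = t₂ , path ⋯ path′ , ready

  rising-≤n : {w : Vec Letter r} → a ≤ n → Rising P a c b w → c ≤ n
  rising-≤n a≤n (br _ w)                = rising-≤n a≤n w
  rising-≤n a≤n (stop (stop _))         = a≤n
  rising-≤n a≤n (stop (ub c<n _)) = c<n

  -- The leftmost ground state column becomes the working column, with an empty low part.
  start : {t : Tens rs} → Ready (suc m) rs t → ∃ λ a → ∃ λ b → ∃ λ c →
    b ≤ c × c ≤ n × c ≤ a + b × Stage (Rotating n) (RisingColumn 0 a c b) m a rs t
  start (rot ∷ ready) with a , b , c , b≤c , c≤n , c≤a+b , stage ← start ready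
    = a , b , c , b≤c , c≤n , c≤a+b , rot ∷ stage
  start (ground (_∷_ {a = a} {b = b} {u = u} (column {top = c} rising a≤n c≤a+b _ _) ground-t))
    = a , b , c , rising-≤ rising , rising-≤n a≤n rising , c≤a+b′ , here (rising-map (λ ()) rising) ground-t
    where
    c≤a+b′ : c ≤ a + b
    c≤a+b′ with m≤n⇒m<n∨m≡n (rising-≤ rising)
    ... | inj₁ b<c  = c≤a+b b<c
    -- A column without bars has c = b.
    ... | inj₂ refl = m≤n+m b a

  -- Induction on the number of ground state columns left: once free of bars, the working column
  -- joins the treated ones.
  solve : ∀ m {rs} {t : Tens rs} → Ready m rs t → ∃ λ t′ → Path rs t t′ × NoBar rs t′
  solve zero ready = _ , done , no-bar ready
    where
    no-bar : ∀ {rs} {t : Tens rs} → Ready 0 rs t → NoBar rs t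
    no-bar (rot ∷ ready) = unbarred rot , no-bar ready
      where
      unbarred : ∀ {r} {z : Vec Letter r} → Allᵛ (Rotating n) z → ∀ p → NoBarLetter (lookup z p)
      unbarred (ub _ _ ∷ _) Fin.zero = tt
      unbarred (br n<n ∷ _) _        = contradiction n<n (<-irrefl refl)
      unbarred (_ ∷ rot) (Fin.suc p) = unbarred rot p
    no-bar (ground []) = tt
  solve (suc m) ready
    with a , b , c , b≤c , c≤n , c≤a+b , stage ← start ready
    -- There are c - b bars to remove, and c ≤ a + b is the invariant k + j ≤ a at k = 0.
    with t₁ , path , ready₁ ← rounds {m = m} (c ∸ b) (m∸n+n≡m b≤c) c≤n z≤n (m≤n+o⇒m∸n≤o _ _ (≤-trans c≤a+b (≤-reflexive (+-comm a b)))) stage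
    with t₂ , path′ , nb ← solve m ready₁
    = t₂ , path ⋯ path′ , nb

-- Adjacent entries of columns and reversed words.

lookup-∷ʳ-inject₁ : (xs : Vec A k) (x : A) (p : Fin k) → lookup (xs ∷ʳ x) (inject₁ p) ≡ lookup xs p
lookup-∷ʳ-inject₁ (_ ∷ _)  x Fin.zero    = refl
lookup-∷ʳ-inject₁ (_ ∷ xs) x (Fin.suc p) = lookup-∷ʳ-inject₁ xs x p

lookup-∷ʳ-fromℕ : (xs : Vec A k) (x : A) → lookup (xs ∷ʳ x) (fromℕ k) ≡ x
lookup-∷ʳ-fromℕ []       x = refl
lookup-∷ʳ-fromℕ (_ ∷ xs) x = lookup-∷ʳ-fromℕ xs x

record Consecutive (u : Vec A k) (x y : A) : Set where
  constructor consecutive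
  field
    {p q}    : Fin k
    next     : toℕ q ≡ suc (toℕ p)
    lookup-p : lookup u p ≡ x
    lookup-q : lookup u q ≡ y

consecutive-∷ʳ : ∀ {u : Vec A k} {x y} z → Consecutive u x y → Consecutive (u ∷ʳ z) x y
consecutive-∷ʳ {u = u} z (consecutive {p} {q} next lp lq) = consecutive {p = inject₁ p} {q = inject₁ q}
  (trans (toℕ-inject₁ q) (trans next (cong suc (sym (toℕ-inject₁ p)))))
  (trans (lookup-∷ʳ-inject₁ u z p) lp) (trans (lookup-∷ʳ-inject₁ u z q) lq)

consecutive-last : (u : Vec A k) (x y : A) → Consecutive ((u ∷ʳ x) ∷ʳ y) x y
consecutive-last {k = k} u x y = consecutive {p = inject₁ (fromℕ k)} {q = fromℕ (suc k)}
  (cong suc (sym (toℕ-inject₁ (fromℕ k))))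
  (trans (lookup-∷ʳ-inject₁ (u ∷ʳ x) y (fromℕ k)) (lookup-∷ʳ-fromℕ u x)) (lookup-∷ʳ-fromℕ (u ∷ʳ x) y)

consecutive-reverse-∷ : ∀ {w : Vec A k} {x y} z → Consecutive (reverse w) x y → Consecutive (reverse (z ∷ w)) x y
consecutive-reverse-∷ {w = w} z con = subst (λ v → Consecutive v _ _) (sym (reverse-∷ z w)) (consecutive-∷ʳ z con)

consecutive-reverse : (w : Vec A k) (x y : A) → Consecutive (reverse (y ∷ x ∷ w)) x y
consecutive-reverse w x y = subst (λ v → Consecutive v x y)
  (sym (trans (reverse-∷ y (x ∷ w)) (cong (_∷ʳ y) (reverse-∷ x w)))) (consecutive-last (reverse w) x y)

cnt≡0 : ∀ p {ls : Vec Letter k} → cnt p ls ≡ 0 → Allᵛ (λ l → p l ≡ false) ls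
cnt≡0 p {[]}     _ = []
cnt≡0 p {l ∷ ls} z with p l in eq
... | false = eq ∷ cnt≡0 p z

-- Classification of ground state columns.

module Classification (n : ℕ) where
  open Rounds n

  private
    Empty : Letter → Set
    Empty _ = ⊥

    empty-inert : ∀ {i k} {w : Vec Letter k} → Allᵛ Empty w → εʷ (suc i) w ≡ 0 × φʷ (suc i) w ≡ 0
    empty-inert [] = refl , refl

  -- The e_i-arrow into l has to be cancelled by φ_i(w ⊗ u_{Λ_a}) = δ_{ib}.
  forced : ∀ {i} l {w : Vec Letter k} → Lifts i a b w → εʷ i (l ∷ w) ≤ δ i a → εˡ i l ≡ 1 → i ≡ b
  forced {a = a} {b} {i} l {w} (lifts ε≤ φ+) ε∷≤ εl = δ≢0⇒≡ (subst (1 ≤_) φ+ (arith (φʷ i w) refl))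
    where
    arith : ∀ p → φʷ i w ≡ p → 1 ≤ p + (δ i a ∸ εʷ i w)
    arith (suc p) _  = s≤s z≤n
    -- If φ_i(w) = 0, the ε_i of the letter is not cancelled within the word, so ε_i(w) + 1 is at
    -- most δ_ia.
    arith zero    φ0 = m+n≤o⇒m≤o∸n 1 (subst (_≤ δ i a)
      (trans (cong (εʷ i w +_) (cong₂ _∸_ εl φ0)) (+-comm (εʷ i w) 1)) ε∷≤)

  module _ {a : ℕ} (a≤n : a ≤ n) where

    -- The letter 1 has ε_i = 0 for all i ≥ 1; the second clause records what ε_0 says about it.
    Admissible : Letter → Set
    Admissible l = ValidLetter n l × (isOne l ≡ true → a ≡ 0)

    -- The column is built from its smallest letter. At weight Λ_b the next letter can only be b + 1
    -- or the bar of b, since its ε_i must be cancelled.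
    classify : (w : Vec Letter k) → Allᵛ Admissible w →
      (∀ {x y} → Consecutive (reverse w) x y → x <L y) →
      (∀ i → i < n → εʷ (suc i) w ≤ δ (suc i) a) →
      ∃ λ b → ∃ λ c → Rising Empty a c b w
    classify [] _ _ _ = a , a , stop (stop [])
    classify (l ∷ w) (adm ∷ adms) inc ε≤
      with b , c , rising ← classify w adms (inc ∘ consecutive-reverse-∷ {w = w} l) (λ i i<n → ≤-trans (m≤m+n _ _) (ε≤ i i<n))
      = prepend l adm w adms inc ε≤ rising
      where
      prepend : ∀ {k b c} l → Admissible l → (w : Vec Letter k) → Allᵛ Admissible w →
        (∀ {x y} → Consecutive (reverse (l ∷ w)) x y → x <L y) →
        (∀ i → i < n → εʷ (suc i) (l ∷ w) ≤ δ (suc i) a) →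
        Rising Empty a c b w → ∃ λ b → ∃ λ c → Rising Empty a c b (l ∷ w)
      prepend (br (suc j)) ((_ , j<n) , _) w _ _ ε≤ rising
        with refl ← forced (br (suc j)) (lifts-rising {i = j} empty-inert rising) (ε≤ j j<n) (trans (ε-br n j<n) (δ-refl j))
        = j , _ , br j<n rising
      -- The letter 1 can only be the smallest entry, and it forces a = 0, so it is a + 1.
      prepend (ub 1) ((_ , 0<n) , a≡0) [] _ _ _ _ with refl ← a≡0 refl = 1 , 1 , stop (ub 0<n (stop []))
      prepend (ub 1) _ (l′ ∷ w) (adm′ ∷ _) inc _ _ = ⊥-elim (not-below-1 l′ adm′ (inc (consecutive-reverse w l′ (ub 1))))
        where
        not-below-1 : ∀ l → Admissible l → ¬ (l <L ub 1)
        not-below-1 (ub zero)    ((() , _) , _) _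
        not-below-1 (ub (suc _)) _              (s≤s ())
        not-below-1 (br _)       _              ()
      prepend (ub (suc (suc j))) ((_ , j<n) , _) w _ inc ε≤ rising
        with refl ← forced (ub (suc (suc j))) (lifts-rising {i = j} empty-inert rising) (ε≤ j (<⇒≤ j<n)) (trans (ε-ub n j<n) (δ-refl j))
        with rising
      ... | stop falling                 = _ , _ , stop (ub j<n falling)
      -- In an increasing column no unbarred letter follows a bar.
      ... | br {w = w′} _ _ = ⊥-elim (inc (consecutive-reverse w′ _ (ub (suc (suc j)))))

  falling-length : {w : Vec Letter k} → Falling Empty a c w → k + a ≡ c
  falling-length (stop []) = refl
  falling-length (ub _ w)  = cong suc (falling-length w)

  -- There are c - a unbarred letters and c - b bars; the additive form avoids truncated
  -- subtraction.
  rising-length : {w : Vec Letter k} → Rising Empty a c b w → k + (a + b) ≡ c + c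
  rising-length {k} {a} {c} (stop w)   = trans (sym (+-assoc k a c)) (cong (_+ c) (falling-length w))
  rising-length {suc k} {a} {c} {b} (br _ w) =
    trans (sym (trans (cong (k +_) (+-suc a b)) (+-suc k (a + b)))) (rising-length w)

  falling-consecutive : {w : Vec Letter k} → a < c → Falling P a c w → ∀ l → Consecutive (reverse (l ∷ w)) (ub c) l
  falling-consecutive a<a (stop _)          _ = contradiction a<a (<-irrefl refl)
  falling-consecutive _   (ub {w = w} _ _) l = consecutive-reverse w _ l

  -- Here c is the largest unbarred letter and its bar the smallest barred one.
  top-consecutive : {w : Vec Letter k} → a < c → b < c → Rising P a c b w → Consecutive (reverse w) (ub c) (br c)
  top-consecutive a<c c<c (stop _) = contradiction c<c (<-irrefl refl)
  top-consecutive a<c b<c (br _ (stop falling)) = falling-consecutive a<c falling _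
  top-consecutive {w = l ∷ w} a<c b<c (br _ rising@(br _ rising′)) =
    consecutive-reverse-∷ {w = w} l (top-consecutive a<c (rising-≤ rising′) rising)

  -- The Kashiwara–Nakashima condition at z = c, where c and its bar are adjacent.
  KN⇒top-≤ : ∀ {u : Vec Letter r} → a ≤ n → IsKNColumn n r u → Rising Empty a c b (reverse u) → b < c → c ≤ a + b
  KN⇒top-≤ {r} {a} {c} {b} {u} a≤n (_ , _ , kn) rising b<c with ≤-<-connex c (a + b) | ≤-<-connex c a
  ... | inj₁ c≤a+b | _ = c≤a+b
  ... | inj₂ _ | inj₁ c≤a = ≤-trans c≤a (m≤m+n a b)
  ... | inj₂ a+b<c | inj₂ a<c
    with consecutive {p} {q} next lp lq ← subst (λ v → Consecutive v (ub c) (br c)) (reverse-involutive u) (top-consecutive a<c b<c rising)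
    = contradiction distance (kn c p q (≤-trans (s≤s z≤n) b<c) (rising-≤n a≤n rising) lp lq)
    where
    -- From r + a + b = 2c and a + b < c it follows that c < r, so the distance 1 is at most r - c,
    -- which is forbidden.
    c<r : c < r
    c<r = +-cancelʳ-< c c r (subst (_< r + c) (rising-length rising) (+-monoʳ-< r a+b<c))
    distance : (ℤ.+ toℕ q) ℤ.- (ℤ.+ toℕ p) ℤ.≤ (ℤ.+ r) ℤ.- (ℤ.+ c)
    distance rewrite next | ℤ.m-n≡m⊖n (suc (toℕ p)) (toℕ p) | ℤ.m-n≡m⊖n r c
      | ℤ.⊖-≥ (n≤1+n (toℕ p)) | ℤ.⊖-≥ (<⇒≤ c<r) | m+n∸n≡m 1 (toℕ p) = ℤ.+≤+ (m<n⇒0<n∸m c<r)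

  -- For b = 0 a nonempty column must contain the bar of 1: without bars, c = b = 0 would leave it
  -- empty.
  φ₀-rising : ∀ {w : Vec Letter (suc k)} → Rising Empty a c b w → (b < c → c ≤ a + b) → cnt isBar1 w ≡ δ 0 b
  φ₀-rising {b = suc b} rising _ = rising-no-1̄ (λ ()) rising
  φ₀-rising {b = zero} (stop (stop (() ∷ _)))
  φ₀-rising {b = zero} (br _ rising) _ = cong suc (rising-no-1̄ (λ ()) rising)

  increasing : {u : Vec Letter r} → IsKNColumn n r u → ∀ {x y} → Consecutive u x y → x <L y
  increasing (_ , inc , _) (consecutive {p} {q} next refl refl) = inc p q (≤-reflexive (sym next))

  classify-column : ∀ {u : Vec Letter r} → a ≤ n → 1 ≤ r → IsKNColumn n r u → (∀ i → i ≤ n → εᶜ i u ≡ δ i a) →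
    ∃ λ b → b ≤ n × Column a b u × (∀ i → i ≤ n → φᶜ i u ≡ δ i b)
  classify-column {suc r} {a} {u} a≤n _ kn ε≡
    = b′ , ≤-trans (rising-≤ rising) (rising-≤n a≤n rising) , col , φ≡
    where
    -- For a > 0 the condition ε_0(u) = 0 rules out the letter 1.
    admissible : ∀ a′ → a ≡ a′ → Allᵛ (λ l → isOne l ≡ true → a ≡ 0) u
    admissible zero    a≡0 = Allᵛ.universal (λ _ _ → a≡0) u
    admissible (suc _) refl = Allᵛ.map (λ p≡false p≡true → contradiction (trans (sym p≡true) p≡false) λ ()) (cnt≡0 isOne (ε≡ 0 z≤n))
    classified = classify a≤n (reverse u)
      (All-reverse (Allᵛ.zip (lookup⁻ (proj₁ kn) , admissible a refl)))
      (λ con → increasing kn (subst (λ v → Consecutive v _ _) (reverse-involutive u) con))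
      (λ i i<n → ≤-reflexive (ε≡ (suc i) i<n))
    b′ = proj₁ classified
    rising : Rising Empty a (proj₁ (proj₂ classified)) b′ (reverse u)
    rising = proj₂ (proj₂ classified)
    φ₀≡ : cnt isBar1 u ≡ δ 0 b′
    φ₀≡ = trans (sym (cnt-reverse isBar1 u)) (φ₀-rising rising (KN⇒top-≤ {u = u} a≤n kn rising))
    col : Column a b′ u
    col = column rising a≤n (KN⇒top-≤ {u = u} a≤n kn rising) (ε≡ 0 z≤n) φ₀≡
    φ≡ : ∀ i → i ≤ n → φᶜ i u ≡ δ i b′
    φ≡ zero    _   = φ₀≡
    φ≡ (suc i) i<n with lifts _ φ+ ← column-lifts {i = i} col = trans (sym (+-identityʳ _))
      (trans (cong (φᶜ (suc i) u +_) (sym (m≤n⇒m∸n≡0 (≤-reflexive (sym (ε≡ (suc i) i<n)))))) φ+)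

  Λ₀≡δ : ∀ i → Λ₀ i ≡ δ i 0
  Λ₀≡δ zero    = refl
  Λ₀≡δ (suc _) = refl

  -- Induction from the right end: the weight φ = Λ_b of one classified column is the ε of its left
  -- neighbour, so b ≤ n and the formula for φ are passed on.
  ground-state : ∀ r rs (u : Tens (r ∷ rs)) → All (λ r → 1 ≤ r × r ≤ n) (r ∷ rs) →
    InB n (r ∷ rs) u → GroundState n (r ∷ rs) u →
    ∃ λ m → ∃ λ b → Ground m b (r ∷ rs) u × b ≤ n × (∀ i → i ≤ n → φᶜ i (proj₁ u) ≡ δ i b)
  ground-state r [] (u , tt) ((1≤r , _) ∷ _) (kn , _) ε≡
    with b , b≤n , col , φ≡ ← classify-column z≤n 1≤r kn
           (λ i i≤n → trans (sym (εC-exact (column-seminormal n r i) u)) (trans (ε≡ i i≤n) (Λ₀≡δ i)))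
    = 1 , b , col ∷ [] , b≤n , φ≡
  ground-state r (r′ ∷ rs) (u , us@(u′ , _)) ((1≤r , _) ∷ bounds) (kn , kns) (ε≡φ , gs)
    with m , a , ground-us , a≤n , φ≡′ ← ground-state r′ rs us bounds kns gs
    with b , b≤n , col , φ≡ ← classify-column a≤n 1≤r kn
           (λ i i≤n → trans (sym (εC-exact (column-seminormal n r i) u))
             (trans (ε≡φ i i≤n) (trans (φC-exact (column-seminormal n r′ i) u′) (φ≡′ i i≤n))))
    = suc m , b , col ∷ ground-us , b≤n , φ≡

theorem5p2 : (n : ℕ) (rs : List ℕ) →
    All (λ r → 1 ≤ r × r ≤ n) rs →
    (u : Tens rs) → InB n rs u → GroundState n rs u →
    Σ (Tens rs) (λ y → DemazurePath n rs u y × NoBar rs y)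
theorem5p2 n []       _      u _   _  = u , done , tt
theorem5p2 n (r ∷ rs) bounds u inB gs
  with m , _ , ground-u , _ ← Classification.ground-state n r rs u bounds inB gs
  = Rounds.solve n m (Rounds.ground ground-u)
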